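{- Suppose $\mathcal D=(\mathcal P,\mathcal B,\mathcal I)$ is a non-trivial $2$-design and $G\le\mathrm{Aut}(\mathcal D)$. Consider the conditions (a) $G^{\mathcal P}$ is $2$-transitive; (b) either $G^{\mathcal B}$ is $2$-transitive, or $G^{\mathcal B}$ is transitive of rank $3$ and $\mathcal D$ has non-intersecting blocks; (c) $G_p$ has two orbits on $\mathcal B$, for any $p\in\mathcal P$; (d) $G_b$ has two orbits on $\mathcal P$, for any $b\in\mathcal B$. Then: (A) The following are equivalent: (i) $\mathcal D$ is $G$-pairwise transitive; (ii) conditions (a), (b), (c) all hold; (iii) conditions (a), (b), (d) all hold. (B) Assume in addition that $\mathcal D$ is symmetric. Then $\mathcal D$ is $G$-pairwise transitive if and only if $G^{\mathcal P}$ is $2$-transitive.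
   Context: A design $\mathcal D=(\mathcal P,\mathcal B,\mathcal I)$ consists of finite sets $\mathcal P$ (points), $\mathcal B$ (blocks) and an incidence relation $\mathcal I\subseteq\mathcal P\times\mathcal B$. It is a $2$-$(v,k,\lambda)$ design (or $2$-design) if $|\mathcal P|=v$, each block is incident with exactly $k$ points, and each pair of distinct points is incident with exactly $\lambda$ common blocks. It is non-trivial if $2<k<v$, and symmetric if $|\mathcal B|=v$. An automorphism is a permutation of $\mathcal P\cup\mathcal B$ leaving $\mathcal P$ and $\mathcal B$ invariant setwise and preserving incidence; $\mathrm{Aut}(\mathcal D)$ is the group of all automorphisms. Two blocks are intersecting if some point is incident with both. For $G\le\mathrm{Aut}(\mathcal D)$, the $2$-design $\mathcal D$ is $G$-pairwise transitive if $G$ is transitive on each of the following five (possibly empty) sets of ordered pairs: pairs of distinct points, incident point-block pairs, non-incident point-block pairs, pairs of distinct intersecting blocks, pairs of non-intersecting blocks. $G^{\mathcal P}$ and $G^{\mathcal B}$ are the permutation groups induced by $G$ on $\mathcal P$ and $\mathcal B$; $G_x$ is the stabiliser of $x$. A transitive permutation group has rank $n$ if a point stabiliser has exactly $n$ orbits. -}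

module Defs where

open import Algebra.Bundles using (Group)
open import Algebra.Morphism.Structures using (module GroupMorphisms)
open import Data.Fin using (Fin)
open import Data.Fin.Permutation using (Permutation′; _⟨$⟩ʳ_; _⟨$⟩ˡ_; _∘ₚ_; inverseˡ; inverseʳ) renaming (id to idₚ; flip to flipₚ; _≈_ to _≈ₚ_)
open import Data.Nat using (ℕ; _<_)
open import Data.Product using (Σ; ∃; _×_; _,_; proj₁; proj₂)
open import Data.Sum using (_⊎_)
open import Data.Vec using (allFin; count)
open import Function.Bundles using (_⇔_; mk⇔; Equivalence)
open import Level using (0ℓ)
open import Relation.Binary.Core using (REL)
open import Relation.Binary.Definitions using (Decidable)
open import Relation.Binary.PropositionalEquality using (_≡_; _≢_; refl; sym; trans; cong; cong₂; subst₂)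
open import Relation.Nullary using (¬_)
open import Relation.Nullary.Decidable using (_×-dec_)
open import Relation.Unary using (Pred)

record Subgroup (𝔾 : Group 0ℓ 0ℓ) : Set₁ where
  open Group 𝔾
  field
    Member    : Pred Carrier 0ℓ
    resp      : ∀ {g h} → g ≈ h → Member g → Member h
    ε-closed  : Member ε
    ∙-closed  : ∀ {g h} → Member g → Member h → Member (g ∙ h)
    ⁻¹-closed : ∀ {g} → Member g → Member (g ⁻¹)

record Hom (𝔾 ℍ : Group 0ℓ 0ℓ) : Set where
  open GroupMorphisms (Group.rawGroup 𝔾) (Group.rawGroup ℍ)
  field
    ⟦_⟧ : Group.Carrier 𝔾 → Group.Carrier ℍ
    isGroupHomomorphism : IsGroupHomomorphism ⟦_⟧
  open IsGroupHomomorphism isGroupHomomorphism public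

image : ∀ {𝔾 ℍ} → Hom 𝔾 ℍ → Subgroup 𝔾 → Subgroup ℍ
image {𝔾} {ℍ} f K = record
  { Member    = λ h → ∃ λ g → K.Member g × ⟦ g ⟧ H.≈ h
  ; resp      = λ { h≈h′ (g , g∈ , e) → g , g∈ , H.trans e h≈h′ }
  ; ε-closed  = G.ε , K.ε-closed , ε-homo
  ; ∙-closed  = λ { (g , g∈ , e) (g′ , g′∈ , e′) →
                    g G.∙ g′ , K.∙-closed g∈ g′∈ , H.trans (homo g g′) (H.∙-cong e e′) }
  ; ⁻¹-closed = λ { (g , g∈ , e) →
                    g G.⁻¹ , K.⁻¹-closed g∈ , H.trans (⁻¹-homo g) (H.⁻¹-cong e) }
  }
  where
  module G = Group 𝔾
  module H = Group ℍ
  module K = Subgroup K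
  open Hom f

record RightAction (𝔾 : Group 0ℓ 0ℓ) (X : Set) : Set where
  open Group 𝔾 using (Carrier; _≈_; _∙_; ε)
  infixl 8 _^_
  field
    _^_        : X → Carrier → X
    ^-cong     : ∀ x {g h} → g ≈ h → x ^ g ≡ x ^ h
    ^-identity : ∀ x → x ^ ε ≡ x
    ^-compat   : ∀ x g h → x ^ (g ∙ h) ≡ x ^ g ^ h

pullback : ∀ {𝔾 ℍ X} → Hom 𝔾 ℍ → RightAction ℍ X → RightAction 𝔾 X
pullback f A = record
  { _^_        = λ x g → x ^ ⟦ g ⟧
  ; ^-cong     = λ x e → ^-cong x (⟦⟧-cong e)
  ; ^-identity = λ x → trans (^-cong x ε-homo) (^-identity x)
  ; ^-compat   = λ x g h → trans (^-cong x (homo g h)) (^-compat x ⟦ g ⟧ ⟦ h ⟧)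
  }
  where
  open Hom f
  open RightAction A

infixr 2 _⊗_

_⊗_ : ∀ {𝔾 X Y} → RightAction 𝔾 X → RightAction 𝔾 Y → RightAction 𝔾 (X × Y)
A ⊗ B = record
  { _^_        = λ { (x , y) g → (x A.^ g) , (y B.^ g) }
  ; ^-cong     = λ { (x , y) e → cong₂ _,_ (A.^-cong x e) (B.^-cong y e) }
  ; ^-identity = λ { (x , y) → cong₂ _,_ (A.^-identity x) (B.^-identity y) }
  ; ^-compat   = λ { (x , y) g h → cong₂ _,_ (A.^-compat x g h) (B.^-compat y g h) }
  }
  where
  module A = RightAction A
  module B = RightAction B

module _ {𝔾 : Group 0ℓ 0ℓ} {X : Set} (K : Subgroup 𝔾) (A : RightAction 𝔾 X) where
  open Group 𝔾 using (_⁻¹) renaming (inverseʳ to ⁻¹-inverseʳ)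
  open Subgroup K
  open RightAction A

  stabiliser : X → Subgroup 𝔾
  stabiliser x = record
    { Member    = λ g → Member g × x ^ g ≡ x
    ; resp      = λ { e (g∈ , fix) → resp e g∈ , trans (sym (^-cong x e)) fix }
    ; ε-closed  = ε-closed , ^-identity x
    ; ∙-closed  = λ { {g} {h} (g∈ , fix) (h∈ , fix′) →
                      ∙-closed g∈ h∈ , trans (^-compat x g h) (trans (cong (_^ h) fix) fix′) }
    ; ⁻¹-closed = λ { {g} (g∈ , fix) →
                      ⁻¹-closed g∈ ,
                      trans (cong (_^ (g ⁻¹)) (sym fix))
                        (trans (sym (^-compat x g (g ⁻¹)))
                          (trans (^-cong x (⁻¹-inverseʳ g)) (^-identity x))) }
    }

  SameOrbit : X → X → Set
  SameOrbit x y = ∃ λ g → Member g × x ^ g ≡ y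

  -- Exactly n orbits: a system of representatives indexed by Fin n.
  HasOrbits : ℕ → Set
  HasOrbits n = Σ (Fin n → X) λ rep →
    (∀ i j → SameOrbit (rep i) (rep j) → i ≡ j) ×
    (∀ x → ∃ λ i → SameOrbit (rep i) x)

  -- S is allowed to be empty.
  TransitiveOn : Pred X 0ℓ → Set
  TransitiveOn S = ∀ x y → S x → S y → SameOrbit x y

  Transitive : Set
  Transitive = ∀ x y → SameOrbit x y

-- _∘ₚ_ composes from left to right, so Sym n acts on the right.
Sym : ℕ → Group 0ℓ 0ℓ
Sym n = record
  { Carrier = Permutation′ n
  ; _≈_     = _≈ₚ_
  ; _∙_     = _∘ₚ_
  ; ε       = idₚ
  ; _⁻¹     = flipₚ
  ; isGroup = record
    { isMonoid = record
      { isSemigroup = record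
        { isMagma = record
          { isEquivalence = record
            { refl  = λ _ → refl
            ; sym   = λ e i → sym (e i)
            ; trans = λ e e′ i → trans (e i) (e′ i)
            }
          ; ∙-cong = λ {π} {π′} {ρ} e e′ i → trans (cong (ρ ⟨$⟩ʳ_) (e i)) (e′ (π′ ⟨$⟩ʳ i))
          }
        ; assoc = λ _ _ _ _ → refl
        }
      ; identity = (λ _ _ → refl) , (λ _ _ → refl)
      }
    ; inverse = (λ π _ → inverseʳ π) , (λ π _ → inverseˡ π)
    ; ⁻¹-cong = λ {π} {ρ} e i →
        trans (sym (inverseˡ ρ))
          (cong (ρ ⟨$⟩ˡ_) (trans (sym (e (π ⟨$⟩ˡ i))) (inverseʳ π)))
    }
  }

natural : ∀ n → RightAction (Sym n) (Fin n)
natural n = record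
  { _^_        = λ i π → π ⟨$⟩ʳ i
  ; ^-cong     = λ i e → e i
  ; ^-identity = λ _ → refl
  ; ^-compat   = λ _ _ _ → refl
  }

PermGroup : ℕ → Set₁
PermGroup n = Subgroup (Sym n)

TwoTransitive : ∀ {n} → PermGroup n → Set
TwoTransitive {n} H = TransitiveOn H (natural n ⊗ natural n) λ { (x , y) → x ≢ y }

TransitiveOfRank : ∀ {n} → PermGroup n → ℕ → Set
TransitiveOfRank {n} H r =
  Transitive H (natural n) × (∀ x → HasOrbits (stabiliser H (natural n) x) (natural n) r)

-- The point set is Fin #points and the block set is Fin #blocks.  Distinct
-- blocks may be incident with the same points.
record Design : Set₁ where
  infix 4 _I_ _I?_
  field
    #points : ℕ
    #blocks : ℕ
  Point = Fin #points
  Block = Fin #blocks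
  field
    _I_  : REL Point Block 0ℓ
    _I?_ : Decidable _I_

  Intersecting : Block → Block → Set
  Intersecting β γ = ∃ λ p → p I β × p I γ

-- λ is a reserved word, hence μ.  The condition 0 < μ is the usual convention
-- that λ is a positive integer; when 2 ≤ k ≤ v it only excludes the empty block
-- set, for which k would be arbitrary.
record IsTwoDesign (D : Design) (v k μ : ℕ) : Set where
  open Design D
  field
    point-count : #points ≡ v
    block-size  : ∀ β → count (λ p → p I? β) (allFin #points) ≡ k
    pair-degree : ∀ p q → p ≢ q → count (λ β → (p I? β) ×-dec (q I? β)) (allFin #blocks) ≡ μ
    μ-positive  : 0 < μ

NonTrivial : (v k : ℕ) → Set
NonTrivial v k = 2 < k × k < v

Symmetric : Design → ℕ → Set
Symmetric D v = Design.#blocks D ≡ v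

-- A permutation of the disjoint union of points and blocks that leaves both
-- sets invariant is a pair of permutations.
record Automorphism (D : Design) : Set where
  open Design D
  field
    onP : Permutation′ #points
    onB : Permutation′ #blocks
    preserves : ∀ p β → p I β ⇔ (onP ⟨$⟩ʳ p) I (onB ⟨$⟩ʳ β)

open Automorphism

Aut : Design → Group 0ℓ 0ℓ
Aut D = record
  { Carrier = Automorphism D
  ; _≈_     = λ g h → onP g ≈ₚ onP h × onB g ≈ₚ onB h
  ; _∙_     = λ g h → record
      { onP = onP g ∘ₚ onP h
      ; onB = onB g ∘ₚ onB h
      ; preserves = λ p β → mk⇔
          (λ i → to (preserves h _ _) (to (preserves g p β) i))
          (λ i → from (preserves g p β) (from (preserves h _ _) i))
      }
  ; ε       = record { onP = idₚ ; onB = idₚ ; preserves = λ _ _ → mk⇔ (λ i → i) (λ i → i) }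
  ; _⁻¹     = λ g → record
      { onP = flipₚ (onP g)
      ; onB = flipₚ (onB g)
      ; preserves = λ p β → mk⇔
          (λ i → from (preserves g _ _)
                   (subst₂ _I_ (sym (inverseʳ (onP g))) (sym (inverseʳ (onB g))) i))
          (λ i → subst₂ _I_ (inverseʳ (onP g)) (inverseʳ (onB g)) (to (preserves g _ _) i))
      }
  ; isGroup = record
    { isMonoid = record
      { isSemigroup = record
        { isMagma = record
          { isEquivalence = record
            { refl  = (λ _ → refl) , (λ _ → refl)
            ; sym   = λ { (e , f) → (λ i → sym (e i)) , (λ i → sym (f i)) }
            ; trans = λ { (e , f) (e′ , f′) → (λ i → trans (e i) (e′ i)) , (λ i → trans (f i) (f′ i)) }
            }
          ; ∙-cong = λ {g} {g′} {h} {h′} → λ { (e , f) (e′ , f′) →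
              SP.∙-cong {onP g} {onP g′} {onP h} {onP h′} e e′ ,
              SB.∙-cong {onB g} {onB g′} {onB h} {onB h′} f f′ }
          }
        ; assoc = λ _ _ _ → (λ _ → refl) , (λ _ → refl)
        }
      ; identity = (λ _ → (λ _ → refl) , (λ _ → refl)) , (λ _ → (λ _ → refl) , (λ _ → refl))
      }
    ; inverse = (λ g → (λ _ → inverseʳ (onP g)) , (λ _ → inverseʳ (onB g)))
              , (λ g → (λ _ → inverseˡ (onP g)) , (λ _ → inverseˡ (onB g)))
    ; ⁻¹-cong = λ {g} {h} → λ { (e , f) →
        SP.⁻¹-cong {onP g} {onP h} e , SB.⁻¹-cong {onB g} {onB h} f }
    }
  }
  where
  open Design D
  open Equivalence using (to; from)
  module SP = Group (Sym #points)
  module SB = Group (Sym #blocks)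

module _ (D : Design) where
  open Design D

  pointRep : Hom (Aut D) (Sym #points)
  pointRep = record
    { ⟦_⟧ = onP
    ; isGroupHomomorphism = record
      { isMonoidHomomorphism = record
        { isMagmaHomomorphism = record
          { isRelHomomorphism = record { cong = proj₁ }
          ; homo = λ _ _ _ → refl
          }
        ; ε-homo = λ _ → refl
        }
      ; ⁻¹-homo = λ _ _ → refl
      }
    }

  blockRep : Hom (Aut D) (Sym #blocks)
  blockRep = record
    { ⟦_⟧ = onB
    ; isGroupHomomorphism = record
      { isMonoidHomomorphism = record
        { isMagmaHomomorphism = record
          { isRelHomomorphism = record { cong = proj₂ }
          ; homo = λ _ _ _ → refl
          }
        ; ε-homo = λ _ → refl
        }
      ; ⁻¹-homo = λ _ _ → refl
      }
    }

  points : RightAction (Aut D) Point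
  points = pullback pointRep (natural #points)

  blocks : RightAction (Aut D) Block
  blocks = pullback blockRep (natural #blocks)

module _ (D : Design) (G : Subgroup (Aut D)) where
  open Design D

  record PairwiseTransitive : Set where
    field
      distinct-points  : TransitiveOn G (points D ⊗ points D) λ { (p , q) → p ≢ q }
      flags            : TransitiveOn G (points D ⊗ blocks D) λ { (p , β) → p I β }
      antiflags        : TransitiveOn G (points D ⊗ blocks D) λ { (p , β) → ¬ (p I β) }
      intersecting     : TransitiveOn G (blocks D ⊗ blocks D) λ { (β , γ) → β ≢ γ × Intersecting β γ }
      non-intersecting : TransitiveOn G (blocks D ⊗ blocks D) λ { (β , γ) → ¬ Intersecting β γ }

  inducedP : PermGroup #points
  inducedP = image (pointRep D) G

  inducedB : PermGroup #blocks
  inducedB = image (blockRep D) G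

  ConditionA : Set
  ConditionA = TwoTransitive inducedP

  ConditionB : Set
  ConditionB = TwoTransitive inducedB
             ⊎ (TransitiveOfRank inducedB 3 × ∃ λ β → ∃ λ γ → ¬ Intersecting β γ)

  ConditionC : Set
  ConditionC = ∀ p → HasOrbits (stabiliser G (points D) p) (blocks D) 2

  ConditionD : Set
  ConditionD = ∀ β → HasOrbits (stabiliser G (blocks D) β) (points D) 2

{-# OPTIONS --safe #-}
module Submission where

-- Part (A).  Colour point-block pairs by incidence and block pairs by
-- "equal / distinct and meeting / disjoint".  These colourings are G-invariant, so
-- once every colour occurs at each x, the stabiliser of x has as many orbits as there
-- are colours exactly when G is transitive on each colour class.
--
-- Part (B).  A variance count shows that distinct blocks meet in exactly μ points, so
-- both N Nᵀ and Nᵀ N equal (k − μ) I + μ J for the incidence matrix N.  If M is the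
-- indicator matrix of a G-orbit on pairs (y , β), then M Nᵀ is an invariant matrix on
-- pairs (y , q), and M is recovered from M Nᵀ.  For y a point, 2-transitivity makes
-- M Nᵀ a combination of I and J, hence M one of N and J: G is transitive on flags and
-- on antiflags.  For y a block, M Nᵀ is then a combination of Nᵀ and J, hence M
-- one of I and J: G is 2-transitive on blocks.

open import Defs
open import Algebra.Bundles using (Group)
open import Data.Bool using (Bool; true; false; if_then_else_)
import Data.Bool.Properties as Bool
open import Data.Empty using (⊥-elim)
open import Data.Fin using (Fin; zero; suc; punchOut)
open import Data.Fin.Permutation using (_⟨$⟩ʳ_; _⟨$⟩ˡ_; inverseˡ; inverseʳ)
open import Data.Fin.Properties using (_≟_; any?; ¬∀⟶∃¬; injective⇒≤; punchOut-injective)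
open import Data.List using (List; []; _∷_; _++_; map; length; allFin; cartesianProduct)
import Data.List.Membership.DecPropositional as DecMembership
open import Data.List.Membership.Propositional using (_∈_; find; lose)
open import Data.List.Membership.Propositional.Properties using (∈-allFin; ∈-cartesianProduct⁺; ∈-map⁺; ∈-++⁺ˡ; ∈-++⁺ʳ)
open import Data.List.Properties using (length-removeAt′)
import Data.List.Relation.Unary.All as All
import Data.List.Relation.Unary.All.Properties as All
open import Data.List.Relation.Unary.Any as Any using (here; there; _─_)
open import Data.Nat using (ℕ; zero; suc; _+_; _*_; _≤_; _<_; s≤s; z≤n; z<s; ∣_-_∣; >-nonZero)
open import Data.Nat.Properties hiding (_≟_)
open import Data.Nat.Tactic.RingSolver using (solve-∀)
open import Data.Product using (∃; _×_; _,_; proj₁; proj₂)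
open import Data.Product.Properties using (≡-dec)
open import Data.Sum using (_⊎_; inj₁; inj₂)
open import Data.Unit using (⊤; tt)
open import Data.Vec using (count; tabulate)
open import Function using (_∘_)
open import Function.Bundles using (_⇔_; mk⇔; Equivalence)
open import Level using (0ℓ)
open import Relation.Binary.Core using (Rel)
open import Relation.Binary.Definitions using (DecidableEquality) renaming (Decidable to Decidable₂)
open import Relation.Binary.PropositionalEquality using (_≡_; _≢_; refl; sym; trans; cong; cong₂; subst; module ≡-Reasoning)
open import Relation.Nullary using (¬_; Dec; does; yes; no)
open import Relation.Nullary.Decidable using (_×-dec_; ¬?; does-⇔; decidable-stable)
open import Relation.Unary using (Pred; Decidable)
open import Algebra.Properties.Semiring.Sum +-*-semiring

-- Finite sums of natural numbers

𝟙ᵇ : Bool → ℕ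
𝟙ᵇ b = if b then 1 else 0

𝟙 : {P : Set} → Dec P → ℕ
𝟙 P? = 𝟙ᵇ (does P?)

𝟙-yes : {P : Set} (P? : Dec P) → P → 𝟙 P? ≡ 1
𝟙-yes (yes _) _ = refl
𝟙-yes (no ¬p) p = ⊥-elim (¬p p)

𝟙-no : {P : Set} (P? : Dec P) → ¬ P → 𝟙 P? ≡ 0
𝟙-no (yes p) ¬p = ⊥-elim (¬p p)
𝟙-no (no _)  _  = refl

𝟙⁻¹ : {P : Set} (P? : Dec P) → 𝟙 P? ≡ 1 → P
𝟙⁻¹ (yes p) _ = p

𝟙-mono-≤ : {P Q : Set} (P? : Dec P) (Q? : Dec Q) → (P → Q) → 𝟙 P? ≤ 𝟙 Q?
𝟙-mono-≤ (no _)  _  _ = z≤n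
𝟙-mono-≤ (yes p) Q? f = ≤-reflexive (sym (𝟙-yes Q? (f p)))

𝟙-idem : {P : Set} (P? : Dec P) → 𝟙 P? * 𝟙 P? ≡ 𝟙 P?
𝟙-idem (yes _) = refl
𝟙-idem (no _)  = refl

𝟙-× : {P Q : Set} (P? : Dec P) (Q? : Dec Q) → 𝟙 (P? ×-dec Q?) ≡ 𝟙 P? * 𝟙 Q?
𝟙-× (yes _) (yes _) = refl
𝟙-× (yes _) (no _)  = refl
𝟙-× (no _)  _       = refl

count-tabulate : ∀ {n} {A : Set} {P : Pred A 0ℓ} (P? : Decidable P) (f : Fin n → A) →
                 count P? (tabulate f) ≡ ∑[ i < n ] 𝟙 (P? (f i))
count-tabulate {zero}  P? f = refl
count-tabulate {suc n} P? f with does (P? (f zero))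
... | true  = cong suc (count-tabulate P? (f ∘ suc))
... | false = count-tabulate P? (f ∘ suc)

sum-const : ∀ n c → ∑[ _ < n ] c ≡ n * c
sum-const zero    c = refl
sum-const (suc n) c = cong (c +_) (sum-const n c)

sum-mono-≤ : ∀ {n} {f g : Fin n → ℕ} → (∀ i → f i ≤ g i) → sum f ≤ sum g
sum-mono-≤ {zero}  f≤g = z≤n
sum-mono-≤ {suc n} f≤g = +-mono-≤ (f≤g zero) (sum-mono-≤ (f≤g ∘ suc))

∑-*-𝟙-≟ : ∀ {n} (f : Fin n → ℕ) i → ∑[ j < n ] (f j * 𝟙 (i ≟ j)) ≡ f i
∑-*-𝟙-≟ {suc n} f zero = begin
  f zero * 1 + ∑[ j < n ] (f (suc j) * 0)  ≡⟨ cong₂ _+_ (*-identityʳ (f zero)) (sum-cong-≗ (λ j → *-zeroʳ (f (suc j)))) ⟩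
  f zero + ∑[ _ < n ] 0                  ≡⟨ cong (f zero +_) (trans (sum-const n 0) (*-zeroʳ n)) ⟩
  f zero + 0                             ≡⟨ +-identityʳ (f zero) ⟩
  f zero                                 ∎
  where open ≡-Reasoning
∑-*-𝟙-≟ {suc n} f (suc i) =
  cong₂ _+_ (*-zeroʳ (f zero)) (∑-*-𝟙-≟ (f ∘ suc) i)

term≤sum : ∀ {n} (f : Fin n → ℕ) i → f i ≤ sum f
term≤sum f zero    = m≤m+n _ _
term≤sum f (suc i) = ≤-trans (term≤sum (f ∘ suc) i) (m≤n+m _ _)

-- If a sum equals one of its terms, this bound forces every other term to vanish.
two-terms≤sum : ∀ {n} (f : Fin n → ℕ) {i j} → i ≢ j → f i + f j ≤ sum f
two-terms≤sum f {zero}  {zero}  i≢j = ⊥-elim (i≢j refl)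
two-terms≤sum f {zero}  {suc j} _   = +-monoʳ-≤ (f zero) (term≤sum (f ∘ suc) j)
two-terms≤sum f {suc i} {zero}  _   =
  ≤-trans (≤-reflexive (+-comm (f (suc i)) (f zero))) (+-monoʳ-≤ (f zero) (term≤sum (f ∘ suc) i))
two-terms≤sum f {suc i} {suc j} i≢j =
  ≤-trans (two-terms≤sum (f ∘ suc) (i≢j ∘ cong suc)) (m≤n+m _ _)

0<∑𝟙⇒∃ : ∀ {n} {P : Pred (Fin n) 0ℓ} (P? : Decidable P) → 0 < ∑[ i < n ] 𝟙 (P? i) → ∃ P
0<∑𝟙⇒∃ {n} P? 0<s with any? P?
... | yes ∃P = ∃P
... | no ¬∃P = ⊥-elim (<-irrefl (sym s≡0) 0<s)
  where
  s≡0 = trans (sum-cong-≗ (λ i → 𝟙-no (P? i) (λ p → ¬∃P (i , p))))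
              (trans (sum-const n 0) (*-zeroʳ n))

∑𝟙<n⇒∃¬ : ∀ {n} {P : Pred (Fin n) 0ℓ} (P? : Decidable P) → ∑[ i < n ] 𝟙 (P? i) < n → ∃ λ i → ¬ P i
∑𝟙<n⇒∃¬ {n} {P} P? s<n = ¬∀⟶∃¬ n P P? λ ∀P →
  <-irrefl (trans (sum-cong-≗ (λ i → 𝟙-yes (P? i) (∀P i))) (trans (sum-const n 1) (*-identityʳ n))) s<n

-- The Gram matrix hypothesis reads N Nᵀ = (k − μ) I + μ J; the conclusion is
-- this identity applied to the vector f.
gram-apply : ∀ {m n} (N : Fin m → Fin n → ℕ) k μ →
  (∀ x y → ∑[ z < n ] (N x z * N y z) + μ * 𝟙 (y ≟ x) ≡ μ + k * 𝟙 (y ≟ x)) →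
  ∀ f y → ∑[ z < n ] (∑[ x < m ] (f x * N x z) * N y z) + μ * f y ≡ μ * sum f + k * f y
gram-apply {m} {n} N k μ gram f y = begin
  ∑[ z < n ] (∑[ x < m ] (f x * N x z) * N y z) + μ * f y
    ≡⟨ cong₂ _+_ swap (cong (μ *_) (sym (∑-*-𝟙-≟ f y))) ⟩
  ∑[ x < m ] (f x * ∑[ z < n ] (N x z * N y z)) + μ * ∑[ x < m ] (f x * δ x)
    ≡⟨ cong (∑[ x < m ] (f x * ∑[ z < n ] (N x z * N y z)) +_) (*-distribˡ-sum μ (λ x → f x * δ x)) ⟩
  ∑[ x < m ] (f x * ∑[ z < n ] (N x z * N y z)) + ∑[ x < m ] (μ * (f x * δ x))
    ≡⟨ ∑-distrib-+ (λ x → f x * ∑[ z < n ] (N x z * N y z)) (λ x → μ * (f x * δ x)) ⟨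
  ∑[ x < m ] (f x * ∑[ z < n ] (N x z * N y z) + μ * (f x * δ x))
    ≡⟨ sum-cong-≗ pointwise ⟩
  ∑[ x < m ] (μ * f x + k * (f x * δ x))
    ≡⟨ ∑-distrib-+ (λ x → μ * f x) (λ x → k * (f x * δ x)) ⟩
  ∑[ x < m ] (μ * f x) + ∑[ x < m ] (k * (f x * δ x))
    ≡⟨ cong₂ _+_ (*-distribˡ-sum μ f) (*-distribˡ-sum k (λ x → f x * δ x)) ⟨
  μ * sum f + k * ∑[ x < m ] (f x * δ x)
    ≡⟨ cong (λ s → μ * sum f + k * s) (∑-*-𝟙-≟ f y) ⟩
  μ * sum f + k * f y ∎
  where
  open ≡-Reasoning
  δ : Fin m → ℕ
  δ x = 𝟙 (y ≟ x)
  swap : ∑[ z < n ] (∑[ x < m ] (f x * N x z) * N y z) ≡ ∑[ x < m ] (f x * ∑[ z < n ] (N x z * N y z))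
  swap = begin
    ∑[ z < n ] (∑[ x < m ] (f x * N x z) * N y z)
      ≡⟨ sum-cong-≗ (λ z → *-distribʳ-sum (N y z) (λ x → f x * N x z)) ⟩
    ∑[ z < n ] ∑[ x < m ] (f x * N x z * N y z)
      ≡⟨ ∑-comm (λ z x → f x * N x z * N y z) ⟩
    ∑[ x < m ] ∑[ z < n ] (f x * N x z * N y z)
      ≡⟨ sum-cong-≗ (λ x → sum-cong-≗ (λ z → *-assoc (f x) (N x z) (N y z))) ⟩
    ∑[ x < m ] ∑[ z < n ] (f x * (N x z * N y z))
      ≡⟨ sum-cong-≗ (λ x → *-distribˡ-sum (f x) (λ z → N x z * N y z)) ⟨
    ∑[ x < m ] (f x * ∑[ z < n ] (N x z * N y z)) ∎
  factor : ∀ a s d μ → a * s + μ * (a * d) ≡ a * (s + μ * d)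
  factor = solve-∀
  expand : ∀ a d μ k → a * (μ + k * d) ≡ μ * a + k * (a * d)
  expand = solve-∀
  pointwise : ∀ x → f x * ∑[ z < n ] (N x z * N y z) + μ * (f x * δ x) ≡ μ * f x + k * (f x * δ x)
  pointwise x = trans (factor (f x) _ (δ x) μ) (trans (cong (f x *_) (gram x y)) (expand (f x) (δ x) μ k))

-- Counting in 2-designs

-- The cross term stands on the left because the naturals have no subtraction. The identity feeds
-- the variance count of block intersections.
square-of-difference : ∀ x y → ∣ x - y ∣ * ∣ x - y ∣ + 2 * (y * x) ≡ x * x + y * y
square-of-difference zero    y       = zeroˡ-case y
  where
  zeroˡ-case : ∀ y → y * y + 2 * (y * 0) ≡ y * y
  zeroˡ-case = solve-∀
square-of-difference (suc x) zero    = zeroʳ-case x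
  where
  zeroʳ-case : ∀ x → suc x * suc x + 2 * (0 * suc x) ≡ suc x * suc x + 0
  zeroʳ-case = solve-∀
square-of-difference (suc x) (suc y) = begin
  d * d + 2 * (suc y * suc x)                ≡⟨ expand d x y ⟩
  d * d + 2 * (y * x) + (2 * x + 2 * y + 2)  ≡⟨ cong (_+ (2 * x + 2 * y + 2)) (square-of-difference x y) ⟩
  x * x + y * y + (2 * x + 2 * y + 2)        ≡⟨ collect x y ⟩
  suc x * suc x + suc y * suc y              ∎
  where
  open ≡-Reasoning
  d = ∣ x - y ∣
  expand : ∀ d x y → d * d + 2 * (suc y * suc x) ≡ d * d + 2 * (y * x) + (2 * x + 2 * y + 2)
  expand = solve-∀
  collect : ∀ x y → x * x + y * y + (2 * x + 2 * y + 2) ≡ suc x * suc x + suc y * suc y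
  collect = solve-∀

module DesignCounting (D : Design) {v k μ : ℕ} (des : IsTwoDesign D v k μ) (2<k : 2 < k) (k<v : k < v) where
  open Design D
  open IsTwoDesign des

  N : Point → Block → ℕ
  N p β = 𝟙 (p I? β)

  block-sum : ∀ β → ∑[ p < #points ] N p β ≡ k
  block-sum β = trans (sym (count-tabulate (_I? β) (λ p → p))) (block-size β)

  pair-sum : ∀ p q → p ≢ q → ∑[ β < #blocks ] (N p β * N q β) ≡ μ
  pair-sum p q p≢q = begin
    ∑[ β < #blocks ] (N p β * N q β)                  ≡⟨ sum-cong-≗ (λ β → 𝟙-× (p I? β) (q I? β)) ⟨
    ∑[ β < #blocks ] 𝟙 ((p I? β) ×-dec (q I? β))      ≡⟨ count-tabulate (λ β → (p I? β) ×-dec (q I? β)) (λ β → β) ⟨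
    count (λ β → (p I? β) ×-dec (q I? β)) (tabulate (λ β → β)) ≡⟨ pair-degree p q p≢q ⟩
    μ                                                 ∎
    where open ≡-Reasoning

  -- The replication number r at `p`; its independence of `p` is established in `degree-constant`.
  degree : Point → ℕ
  degree p = ∑[ β < #blocks ] N p β

  -- Entrywise form of N Nᵀ = (r - μ) I + μ J, with the negative term moved to the left.
  point-gram : ∀ p q → ∑[ β < #blocks ] (N p β * N q β) + μ * 𝟙 (q ≟ p) ≡ μ + degree q * 𝟙 (q ≟ p)
  point-gram p q with q ≟ p
  ... | yes refl = trans (cong₂ _+_ (sum-cong-≗ (λ β → 𝟙-idem (p I? β))) (*-identityʳ μ))
                         (trans (+-comm (degree p) μ) (cong (μ +_) (sym (*-identityʳ (degree p)))))
  ... | no q≢p   = trans (cong₂ _+_ (pair-sum p q (q≢p ∘ sym)) (*-zeroʳ μ))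
                         (cong (μ +_) (sym (*-zeroʳ (degree q))))

  -- Double count of the pairs (p , β) with `p` and `q` both on β: there are r k by blocks, and r +
  -- (v - 1) μ by points.
  degree-equation : ∀ q → degree q * k + μ ≡ v * μ + degree q
  degree-equation q = begin
    degree q * k + μ
      ≡⟨ cong₂ _+_ double (sym (∑-*-𝟙-≟ (λ _ → μ) q)) ⟩
    ∑[ p < #points ] ∑[ β < #blocks ] (N p β * N q β) + ∑[ p < #points ] (μ * 𝟙 (q ≟ p))
      ≡⟨ ∑-distrib-+ (λ p → ∑[ β < #blocks ] (N p β * N q β)) (λ p → μ * 𝟙 (q ≟ p)) ⟨
    ∑[ p < #points ] (∑[ β < #blocks ] (N p β * N q β) + μ * 𝟙 (q ≟ p))
      ≡⟨ sum-cong-≗ (λ p → point-gram p q) ⟩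
    ∑[ p < #points ] (μ + degree q * 𝟙 (q ≟ p))
      ≡⟨ ∑-distrib-+ (λ _ → μ) (λ p → degree q * 𝟙 (q ≟ p)) ⟩
    ∑[ _ < #points ] μ + ∑[ p < #points ] (degree q * 𝟙 (q ≟ p))
      ≡⟨ cong₂ _+_ (trans (sum-const #points μ) (cong (_* μ) point-count)) (∑-*-𝟙-≟ (λ _ → degree q) q) ⟩
    v * μ + degree q ∎
    where
    open ≡-Reasoning
    double : degree q * k ≡ ∑[ p < #points ] ∑[ β < #blocks ] (N p β * N q β)
    double = begin
      degree q * k
        ≡⟨ *-distribʳ-sum k (N q) ⟩
      ∑[ β < #blocks ] (N q β * k)
        ≡⟨ sum-cong-≗ (λ β → trans (*-comm (N q β) k) (cong (_* N q β) (sym (block-sum β)))) ⟩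
      ∑[ β < #blocks ] (∑[ p < #points ] N p β * N q β)
        ≡⟨ sum-cong-≗ (λ β → *-distribʳ-sum (N q β) (λ p → N p β)) ⟩
      ∑[ β < #blocks ] ∑[ p < #points ] (N p β * N q β)
        ≡⟨ ∑-comm (λ β p → N p β * N q β) ⟩
      ∑[ p < #points ] ∑[ β < #blocks ] (N p β * N q β) ∎

  degree-constant : ∀ p q → degree p ≡ degree q
  degree-constant p q = solution-unique k 2<k (degree-equation p) (degree-equation q)
    where
    solution-unique : ∀ {x y} k → 2 < k → x * k + μ ≡ v * μ + x → y * k + μ ≡ v * μ + y → x ≡ y
    solution-unique {x} {y} (suc (suc j)) (s≤s (s≤s _)) ex ey =
      -- With k = j + 2 both equations become r (k - 1) + μ = v μ, and the nonzero factor k - 1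
      -- cancels.
      *-cancelʳ-≡ x y (suc j) (+-cancelʳ-≡ μ _ _ (trans (shift x ex) (sym (shift y ey))))
      where
      regroup : ∀ x j μ → x * suc j + μ + x ≡ x * suc (suc j) + μ
      regroup = solve-∀
      shift : ∀ x → x * suc (suc j) + μ ≡ v * μ + x → x * suc j + μ ≡ v * μ
      shift x e = +-cancelʳ-≡ x _ _ (trans (regroup x j μ) e)

  -- Only the existence of these witnesses matters; `abstract` keeps the counting behind them from
  -- unfolding.
  abstract
    another-point : (p : Point) → ∃ λ (q : Point) → p ≢ q
    another-point p = ∑𝟙<n⇒∃¬ (p ≟_)
      (≤-<-trans (≤-reflexive (trans (sum-cong-≗ (λ q → sym (*-identityˡ (𝟙 (p ≟ q))))) (∑-*-𝟙-≟ (λ _ → 1) p)))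
                 (≤-trans (<-trans (<-trans (s≤s z<s) 2<k) k<v) (≤-reflexive (sym point-count))))

    point-on : ∀ β → ∃ λ p → p I β
    point-on β = 0<∑𝟙⇒∃ (_I? β) (subst (0 <_) (sym (block-sum β)) (<-trans z<s 2<k))

    point-off : ∀ β → ∃ λ p → ¬ p I β
    point-off β = ∑𝟙<n⇒∃¬ (_I? β) (subst (_ <_) (sym point-count) (subst (_< v) (sym (block-sum β)) k<v))

    joining-block : ∀ p q → p ≢ q → ∃ λ β → p I β × q I β
    joining-block p q p≢q = 0<∑𝟙⇒∃ (λ β → (p I? β) ×-dec (q I? β))
      (subst (0 <_) (sym (trans (sum-cong-≗ (λ β → 𝟙-× (p I? β) (q I? β))) (pair-sum p q p≢q))) μ-positive)

    block-on : ∀ p → ∃ λ β → p I β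
    block-on p =
      let q , p≢q = another-point p
          β , p∈β , _ = joining-block p q p≢q
      in β , p∈β

    -- A block joining a point on β to a point off β meets β and differs from it. This makes the
    -- colour "distinct and meeting" occur at every block.
    meeting-block : ∀ β → ∃ λ γ → β ≢ γ × Intersecting β γ
    meeting-block β
      with p , p∈β ← point-on β
      with q , q∉β ← point-off β
      with γ , p∈γ , q∈γ ← joining-block p q (λ { refl → q∉β p∈β })
      = γ , (λ { refl → q∉β q∈γ }) , p , p∈β , p∈γ

  -- Symmetric designs and their block intersection numbers

  module _ (symmetric : #blocks ≡ v) where

    -- Counting all flags by points and by blocks gives v r = v k, and v is nonzero.
    degree≡k : ∀ q → degree q ≡ k
    degree≡k q = *-cancelˡ-≡ (degree q) k v {{>-nonZero (≤-<-trans z≤n k<v)}} (begin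
      v * degree q                              ≡⟨ cong (_* degree q) point-count ⟨
      #points * degree q                        ≡⟨ sum-const #points (degree q) ⟨
      ∑[ _ < #points ] degree q                 ≡⟨ sum-cong-≗ (λ p → degree-constant q p) ⟩
      ∑[ p < #points ] ∑[ β < #blocks ] N p β   ≡⟨ ∑-comm N ⟩
      ∑[ β < #blocks ] ∑[ p < #points ] N p β   ≡⟨ sum-cong-≗ block-sum ⟩
      ∑[ _ < #blocks ] k                        ≡⟨ sum-const #blocks k ⟩
      #blocks * k                               ≡⟨ cong (_* k) symmetric ⟩
      v * k                                     ∎)
      where open ≡-Reasoning

    k-equation : Point → k * k + μ ≡ v * μ + k
    k-equation p = subst (λ d → d * k + μ ≡ v * μ + d) (degree≡k p) (degree-equation p)

    -- If k ≤ μ, then k² + μ ≤ (k + 1) μ ≤ v μ < v μ + k, against `k-equation`. The strict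
    -- inequality is what later permits division by k - μ.
    μ<k : Point → μ < k
    μ<k p with <-≤-connex μ k
    ... | inj₁ μ<k = μ<k
    ... | inj₂ k≤μ = ⊥-elim (<-irrefl (k-equation p) (begin-strict
      k * k + μ   ≤⟨ +-monoˡ-≤ μ (*-monoʳ-≤ k k≤μ) ⟩
      k * μ + μ   ≡⟨ +-comm (k * μ) μ ⟩
      suc k * μ   ≤⟨ *-monoˡ-≤ μ k<v ⟩
      v * μ       <⟨ m<m+n (v * μ) (<-trans z<s 2<k) ⟩
      v * μ + k   ∎))
      where open ≤-Reasoning

    meet : Block → Block → ℕ
    meet β γ = ∑[ p < #points ] (N p β * N p γ)

    meet-self : ∀ β → meet β β ≡ k
    meet-self β = trans (sum-cong-≗ (λ p → 𝟙-idem (p I? β))) (block-sum β)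

    -- First moment of the intersection sizes: each of the k points of β is counted once for each of
    -- the k blocks through it.
    ∑meet : ∀ β → ∑[ γ < #blocks ] meet β γ ≡ k * k
    ∑meet β = begin
      ∑[ γ < #blocks ] ∑[ p < #points ] (N p β * N p γ)  ≡⟨ ∑-comm (λ γ p → N p β * N p γ) ⟩
      ∑[ p < #points ] ∑[ γ < #blocks ] (N p β * N p γ)  ≡⟨ sum-cong-≗ (λ p → *-distribˡ-sum (N p β) (N p)) ⟨
      ∑[ p < #points ] (N p β * degree p)                ≡⟨ sum-cong-≗ (λ p → cong (N p β *_) (degree≡k p)) ⟩
      ∑[ p < #points ] (N p β * k)                       ≡⟨ *-distribʳ-sum k (λ p → N p β) ⟨
      ∑[ p < #points ] N p β * k                         ≡⟨ cong (_* k) (block-sum β) ⟩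
      k * k                                              ∎
      where open ≡-Reasoning

    -- Second moment: expanding one factor leaves the sum, over the points q of β, of the entry at q
    -- of N Nᵀ applied to the indicator vector of β. Each such entry is μ k + k - μ.
    ∑meet² : ∀ β → ∑[ γ < #blocks ] (meet β γ * meet β γ) + μ * k ≡ μ * k * k + k * k
    ∑meet² β = begin
      ∑[ γ < #blocks ] (meet β γ * meet β γ) + μ * k
        ≡⟨ cong₂ _+_ expand (cong (μ *_) (sym (block-sum β))) ⟩
      ∑[ q < #points ] (row q * N q β) + μ * ∑[ q < #points ] N q β
        ≡⟨ cong (∑[ q < #points ] (row q * N q β) +_) (*-distribˡ-sum μ (λ q → N q β)) ⟩
      ∑[ q < #points ] (row q * N q β) + ∑[ q < #points ] (μ * N q β)
        ≡⟨ ∑-distrib-+ (λ q → row q * N q β) (λ q → μ * N q β) ⟨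
      ∑[ q < #points ] (row q * N q β + μ * N q β)
        ≡⟨ sum-cong-≗ pointwise ⟩
      ∑[ q < #points ] ((μ * k + k) * N q β)
        ≡⟨ *-distribˡ-sum (μ * k + k) (λ q → N q β) ⟨
      (μ * k + k) * ∑[ q < #points ] N q β
        ≡⟨ cong ((μ * k + k) *_) (block-sum β) ⟩
      (μ * k + k) * k
        ≡⟨ *-distribʳ-+ k (μ * k) k ⟩
      μ * k * k + k * k ∎
      where
      open ≡-Reasoning
      row : Point → ℕ
      row q = ∑[ γ < #blocks ] (meet β γ * N q γ)
      expand : ∑[ γ < #blocks ] (meet β γ * meet β γ) ≡ ∑[ q < #points ] (row q * N q β)
      expand = begin
        ∑[ γ < #blocks ] (meet β γ * meet β γ)
          ≡⟨ sum-cong-≗ (λ γ → *-distribˡ-sum (meet β γ) (λ q → N q β * N q γ)) ⟩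
        ∑[ γ < #blocks ] ∑[ q < #points ] (meet β γ * (N q β * N q γ))
          ≡⟨ ∑-comm (λ γ q → meet β γ * (N q β * N q γ)) ⟩
        ∑[ q < #points ] ∑[ γ < #blocks ] (meet β γ * (N q β * N q γ))
          ≡⟨ sum-cong-≗ (λ q → sum-cong-≗ (λ γ → trans (cong (meet β γ *_) (*-comm (N q β) (N q γ))) (sym (*-assoc (meet β γ) (N q γ) (N q β))))) ⟩
        ∑[ q < #points ] ∑[ γ < #blocks ] (meet β γ * N q γ * N q β)
          ≡⟨ sum-cong-≗ (λ q → *-distribʳ-sum (N q β) (λ γ → meet β γ * N q γ)) ⟨
        ∑[ q < #points ] (row q * N q β) ∎
      gram : ∀ p q → ∑[ γ < #blocks ] (N p γ * N q γ) + μ * 𝟙 (q ≟ p) ≡ μ + k * 𝟙 (q ≟ p)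
      gram p q = trans (point-gram p q) (cong (λ d → μ + d * 𝟙 (q ≟ p)) (degree≡k q))
      row-value : ∀ q → row q + μ * N q β ≡ μ * k + k * N q β
      row-value q = trans (gram-apply N k μ gram (λ p → N p β) q) (cong (λ s → μ * s + k * N q β) (block-sum β))
      factor : ∀ r m n → r * n + m * (n * n) ≡ (r + m * n) * n
      factor = solve-∀
      regroup : ∀ m k n → (m + k * n) * n ≡ m * n + k * (n * n)
      regroup = solve-∀
      pointwise : ∀ q → row q * N q β + μ * N q β ≡ (μ * k + k) * N q β
      pointwise q = begin
        row q * N q β + μ * N q β              ≡⟨ cong (λ n → row q * N q β + μ * n) (𝟙-idem (q I? β)) ⟨
        row q * N q β + μ * (N q β * N q β)    ≡⟨ factor (row q) μ (N q β) ⟩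
        (row q + μ * N q β) * N q β            ≡⟨ cong (_* N q β) (row-value q) ⟩
        (μ * k + k * N q β) * N q β            ≡⟨ regroup (μ * k) k (N q β) ⟩
        μ * k * N q β + k * (N q β * N q β)    ≡⟨ cong (λ n → μ * k * N q β + k * n) (𝟙-idem (q I? β)) ⟩
        μ * k * N q β + k * N q β              ≡⟨ *-distribʳ-+ (N q β) (μ * k) k ⟨
        (μ * k + k) * N q β                    ∎

    -- The squares of |β ∩ γ| − μ, summed over all γ, add up to the term
    -- γ = β alone, so all the other terms vanish.
    meet-distinct : ∀ {β γ} → β ≢ γ → meet β γ ≡ μ
    meet-distinct {β} {γ} β≢γ = ∣m-n∣≡0⇒m≡n (m*m≡0⇒m≡0 (n≤0⇒n≡0 (+-cancelˡ-≤ (d² β) (d² γ) 0 (begin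
      d² β + d² γ              ≤⟨ two-terms≤sum d² β≢γ ⟩
      sum d²                   ≡⟨ ∑d²≡ ⟩
      d² β                     ≡⟨ +-identityʳ (d² β) ⟨
      d² β + 0                 ∎))))
      where
      m*m≡0⇒m≡0 : ∀ {m} → m * m ≡ 0 → m ≡ 0
      m*m≡0⇒m≡0 {zero} _ = refl
      d² : Block → ℕ
      d² δ = ∣ meet β δ - μ ∣ * ∣ meet β δ - μ ∣
      ∑d² : sum d² + 2 * (μ * (k * k)) ≡ ∑[ δ < #blocks ] (meet β δ * meet β δ) + v * (μ * μ)
      ∑d² = begin-equality
        sum d² + 2 * (μ * (k * k))
          ≡⟨ cong (λ s → sum d² + 2 * (μ * s)) (∑meet β) ⟨
        sum d² + 2 * (μ * ∑[ δ < #blocks ] meet β δ)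
          ≡⟨ cong (λ s → sum d² + 2 * s) (*-distribˡ-sum μ (meet β)) ⟩
        sum d² + 2 * ∑[ δ < #blocks ] (μ * meet β δ)
          ≡⟨ cong (sum d² +_) (*-distribˡ-sum 2 (λ δ → μ * meet β δ)) ⟩
        sum d² + ∑[ δ < #blocks ] (2 * (μ * meet β δ))
          ≡⟨ ∑-distrib-+ d² (λ δ → 2 * (μ * meet β δ)) ⟨
        ∑[ δ < #blocks ] (d² δ + 2 * (μ * meet β δ))
          ≡⟨ sum-cong-≗ (λ δ → square-of-difference (meet β δ) μ) ⟩
        ∑[ δ < #blocks ] (meet β δ * meet β δ + μ * μ)
          ≡⟨ ∑-distrib-+ (λ δ → meet β δ * meet β δ) (λ _ → μ * μ) ⟩
        ∑[ δ < #blocks ] (meet β δ * meet β δ) + ∑[ _ < #blocks ] (μ * μ)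
          ≡⟨ cong (∑[ δ < #blocks ] (meet β δ * meet β δ) +_) (trans (sum-const #blocks (μ * μ)) (cong (_* (μ * μ)) symmetric)) ⟩
        ∑[ δ < #blocks ] (meet β δ * meet β δ) + v * (μ * μ) ∎
        where open ≤-Reasoning
      d²β : d² β + 2 * (μ * k) ≡ k * k + μ * μ
      d²β = subst (λ x → ∣ x - μ ∣ * ∣ x - μ ∣ + 2 * (μ * k) ≡ k * k + μ * μ) (sym (meet-self β)) (square-of-difference k μ)
      open ≤-Reasoning
      S = ∑[ δ < #blocks ] (meet β δ * meet β δ)
      r₁ : ∀ s μ k → s + (2 * (μ * (k * k)) + 2 * (μ * k)) ≡ s + 2 * (μ * (k * k)) + (μ * k + μ * k)
      r₁ = solve-∀
      r₂ : ∀ S μ k v → S + v * (μ * μ) + (μ * k + μ * k) ≡ (S + μ * k) + μ * (v * μ + k)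
      r₂ = solve-∀
      r₃ : ∀ μ k → μ * k * k + k * k + μ * (k * k + μ) ≡ k * k + μ * μ + 2 * (μ * (k * k))
      r₃ = solve-∀
      r₄ : ∀ d μ k → d + 2 * (μ * k) + 2 * (μ * (k * k)) ≡ d + (2 * (μ * (k * k)) + 2 * (μ * k))
      r₄ = solve-∀
      ∑d²≡ : sum d² ≡ d² β
      -- The added constants are the cross terms of `sum d²` and of `d² β`. With them on both sides,
      -- the two moments and k² + μ = v μ + k can be substituted without subtraction.
      ∑d²≡ = +-cancelʳ-≡ (2 * (μ * (k * k)) + 2 * (μ * k)) (sum d²) (d² β) (begin-equality
        sum d² + (2 * (μ * (k * k)) + 2 * (μ * k))        ≡⟨ r₁ (sum d²) μ k ⟩
        sum d² + 2 * (μ * (k * k)) + (μ * k + μ * k)      ≡⟨ cong (_+ (μ * k + μ * k)) ∑d² ⟩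
        S + v * (μ * μ) + (μ * k + μ * k)                 ≡⟨ r₂ S μ k v ⟩
        (S + μ * k) + μ * (v * μ + k)                     ≡⟨ cong₂ (λ s t → s + μ * t) (∑meet² β) (sym (k-equation (proj₁ (point-on β)))) ⟩
        μ * k * k + k * k + μ * (k * k + μ)               ≡⟨ r₃ μ k ⟩
        k * k + μ * μ + 2 * (μ * (k * k))                 ≡⟨ cong (_+ 2 * (μ * (k * k))) d²β ⟨
        d² β + 2 * (μ * k) + 2 * (μ * (k * k))            ≡⟨ r₄ (d² β) μ k ⟩
        d² β + (2 * (μ * (k * k)) + 2 * (μ * k))          ∎)

    -- The Gram identity with points and blocks exchanged, in the shape that `gram-apply` takes for
    -- Nᵀ.
    block-gram : ∀ β γ → meet β γ + μ * 𝟙 (γ ≟ β) ≡ μ + k * 𝟙 (γ ≟ β)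
    block-gram β γ with γ ≟ β
    ... | yes refl = trans (cong₂ _+_ (meet-self β) (*-identityʳ μ)) (trans (+-comm k μ) (cong (μ +_) (sym (*-identityʳ k))))
    ... | no γ≢β   = trans (cong₂ _+_ (meet-distinct (γ≢β ∘ sym)) (*-zeroʳ μ)) (cong (μ +_) (sym (*-zeroʳ k)))

-- Group actions

-- The section `s` is injective, hence surjective by finiteness, hence a two-sided inverse of `f`.
right-inverse⇒injective : ∀ {n} (f s : Fin n → Fin n) → (∀ i → f (s i) ≡ i) → ∀ {i j} → f i ≡ f j → i ≡ j
right-inverse⇒injective f s fs {i} {j} fi≡fj = trans (sym (s-surjective i)) (trans (cong s fi≡fj) (s-surjective j))
  where
  s-injective : ∀ {a b} → s a ≡ s b → a ≡ b
  s-injective {a} {b} e = trans (sym (fs a)) (trans (cong f e) (fs b))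

  hit : ∀ {m} (t : Fin m → Fin m) → (∀ {a b} → t a ≡ t b → a ≡ b) → ∀ i → ∃ λ a → i ≡ t a
  hit {suc m} t inj i with any? (λ a → i ≟ t a)
  ... | yes found = found
  -- Punching out a missed value would inject m + 1 elements into m.
  ... | no missed = ⊥-elim (1+n≰n (injective⇒≤ {f = λ a → punchOut (λ e → missed (a , e))}
                              (λ {a} {b} e → inj (punchOut-injective {i = i} _ _ e))))

  s-surjective : ∀ i → s (f i) ≡ i
  s-surjective i with a , refl ← hit s s-injective i = cong s (fs a)

module _ {𝔾 : Group 0ℓ 0ℓ} {X : Set} (K : Subgroup 𝔾) (A : RightAction 𝔾 X) where
  open Group 𝔾 using (_∙_; ε; _⁻¹) renaming (inverseʳ to ⁻¹-inverseʳ)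
  open Subgroup K
  open RightAction A

  sameOrbit-refl : ∀ x → SameOrbit K A x x
  sameOrbit-refl x = ε , ε-closed , ^-identity x

  sameOrbit-trans : ∀ {x y z} → SameOrbit K A x y → SameOrbit K A y z → SameOrbit K A x z
  sameOrbit-trans {x} (g , g∈ , e) (h , h∈ , e′) =
    g ∙ h , ∙-closed g∈ h∈ , trans (^-compat x g h) (trans (cong (_^ h) e) e′)

  sameOrbit-sym : ∀ {x y} → SameOrbit K A x y → SameOrbit K A y x
  sameOrbit-sym {x} (g , g∈ , e) =
    g ⁻¹ , ⁻¹-closed g∈ ,
    trans (cong (_^ (g ⁻¹)) (sym e)) (trans (sym (^-compat x g (g ⁻¹))) (trans (^-cong x (⁻¹-inverseʳ g)) (^-identity x)))

  -- Each colour class is a nonempty union of orbits, so n classes and n orbits can only match if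
  -- every class is a single orbit.
  hasOrbits⇔ : ∀ {n} (c : X → Fin n) → (∀ x {g} → Member g → c (x ^ g) ≡ c x) → (∀ i → ∃ λ x → c x ≡ i) →
               HasOrbits K A n ⇔ (∀ x y → c x ≡ c y → SameOrbit K A x y)
  hasOrbits⇔ {n} c invariant section = mk⇔ to from
    where
    invariant′ : ∀ {x y} → SameOrbit K A x y → c x ≡ c y
    invariant′ {x} (g , g∈ , refl) = sym (invariant x g∈)

    to : HasOrbits K A n → ∀ x y → c x ≡ c y → SameOrbit K A x y
    to (rep , _ , cover) x y cx≡cy = sameOrbit-trans (sameOrbit-sym (proj₂ (cover x)))
      (subst (λ i → SameOrbit K A (rep i) y) (sym same-index) (proj₂ (cover y)))
      where
      -- Sends a colour to the number of an orbit of that colour. It is a section of the colouring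
      -- of orbit numbers, which is therefore injective.
      index : Fin n → Fin n
      index i = proj₁ (cover (proj₁ (section i)))
      colour-index : ∀ i → c (rep (index i)) ≡ i
      colour-index i = trans (invariant′ (proj₂ (cover (proj₁ (section i))))) (proj₂ (section i))
      same-index : proj₁ (cover x) ≡ proj₁ (cover y)
      same-index = right-inverse⇒injective (c ∘ rep) index colour-index
        (trans (invariant′ (proj₂ (cover x))) (trans cx≡cy (sym (invariant′ (proj₂ (cover y))))))

    from : (∀ x y → c x ≡ c y → SameOrbit K A x y) → HasOrbits K A n
    from tr = (λ i → proj₁ (section i))
            , (λ i j o → trans (sym (proj₂ (section i))) (trans (invariant′ o) (proj₂ (section j))))
            , (λ x → c x , tr _ x (proj₂ (section (c x))))

  distinct-pairs⇒transitive : DecidableEquality X →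
    (∀ x y x′ y′ → x ≢ y → x′ ≢ y′ → SameOrbit K (A ⊗ A) (x , y) (x′ , y′)) → Transitive K A
  distinct-pairs⇒transitive _≟ₓ_ tr x y with x ≟ₓ y
  ... | yes refl = sameOrbit-refl x
  ... | no x≢y with g , g∈ , e ← tr x y y x x≢y (x≢y ∘ sym) = g , g∈ , cong proj₁ e

  diagonal : Transitive K A → ∀ x y → SameOrbit K (A ⊗ A) (x , x) (y , y)
  diagonal tr x y with g , g∈ , e ← tr x y = g , g∈ , cong₂ _,_ e e

module _ {𝔾 : Group 0ℓ 0ℓ} {X Y : Set} (K : Subgroup 𝔾) (A : RightAction 𝔾 X) (B : RightAction 𝔾 Y) where
  open Subgroup K
  private
    module A = RightAction A
    module B = RightAction B

  sameOrbit-swap : ∀ {x y x′ y′} → SameOrbit K (A ⊗ B) (x , y) (x′ , y′) → SameOrbit K (B ⊗ A) (y , x) (y′ , x′)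
  sameOrbit-swap (g , g∈ , e) = g , g∈ , cong₂ _,_ (cong proj₂ e) (cong proj₁ e)

  -- For a transitive action on X, orbits on X × Y correspond to orbits of a stabiliser on Y: first
  -- move x to x′, then finish inside the stabiliser of x′. The colour count then applies at each x.
  stabilisers-hasOrbits⇔ : ∀ {n} (c : X → Y → Fin n) →
    (∀ x y {g} → Member g → c (x A.^ g) (y B.^ g) ≡ c x y) →
    (∀ x i → ∃ λ y → c x y ≡ i) →
    Transitive K A →
    (∀ x → HasOrbits (stabiliser K A x) B n) ⇔
    (∀ x y x′ y′ → c x y ≡ c x′ y′ → SameOrbit K (A ⊗ B) (x , y) (x′ , y′))
  stabilisers-hasOrbits⇔ {n} c invariant section tr = mk⇔ to from
    where
    module At x = Equivalence (hasOrbits⇔ (stabiliser K A x) B (c x)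
      (λ y {g} (g∈ , fix) → trans (cong (λ z → c z (y B.^ g)) (sym fix)) (invariant x y g∈)) (section x))

    to : (∀ x → HasOrbits (stabiliser K A x) B n) →
         ∀ x y x′ y′ → c x y ≡ c x′ y′ → SameOrbit K (A ⊗ B) (x , y) (x′ , y′)
    to orbits x y x′ y′ e
      with g , g∈ , refl ← tr x x′
      with h , (h∈ , fix) , eq ← At.to x′ (orbits x′) (y B.^ g) y′ (trans (invariant x y g∈) e)
      = sameOrbit-trans K (A ⊗ B) (g , g∈ , refl) (h , h∈ , cong₂ _,_ fix eq)

    from : (∀ x y x′ y′ → c x y ≡ c x′ y′ → SameOrbit K (A ⊗ B) (x , y) (x′ , y′)) →
           ∀ x → HasOrbits (stabiliser K A x) B n
    from trans-on x = At.from x λ y y′ e →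
      let g , g∈ , eq = trans-on x y x y′ e in g , (g∈ , cong proj₁ eq) , cong proj₂ eq

module _ {𝔾 ℍ : Group 0ℓ 0ℓ} {X : Set} (f : Hom 𝔾 ℍ) (K : Subgroup 𝔾) (A : RightAction ℍ X) where
  open RightAction A

  -- Translates conditions on the induced permutation groups into conditions on G itself.
  sameOrbit-image⇔ : ∀ {x y} → SameOrbit (image f K) A x y ⇔ SameOrbit K (pullback f A) x y
  sameOrbit-image⇔ = mk⇔
    (λ { (h , (g , g∈ , e) , eq) → g , g∈ , trans (^-cong _ e) eq })
    (λ { (g , g∈ , eq) → Hom.⟦_⟧ f g , (g , g∈ , Group.refl ℍ) , eq })

  sameOrbit-image²⇔ : ∀ {x y x′ y′} → SameOrbit (image f K) (A ⊗ A) (x , y) (x′ , y′) ⇔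
                      SameOrbit K (pullback f A ⊗ pullback f A) (x , y) (x′ , y′)
  sameOrbit-image²⇔ = mk⇔
    (λ { (h , (g , g∈ , e) , eq) → g , g∈ , trans (cong₂ _,_ (^-cong _ e) (^-cong _ e)) eq })
    (λ { (g , g∈ , eq) → Hom.⟦_⟧ f g , (g , g∈ , Group.refl ℍ) , eq })

-- Membership in a subgroup need not be decidable, so orbits are replaced by
-- sets reachable under finitely many elements of the subgroup.

∈⇒≡⊎∈-─ : ∀ {X : Set} {x y : X} {xs} → x ∈ xs → (y∈ : y ∈ xs) → x ≡ y ⊎ x ∈ (xs ─ y∈)
∈⇒≡⊎∈-─ (here refl) (here refl) = inj₁ refl
∈⇒≡⊎∈-─ (here refl) (there _)   = inj₂ (here refl)
∈⇒≡⊎∈-─ (there x∈)  (here refl) = inj₂ x∈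
∈⇒≡⊎∈-─ (there x∈)  (there y∈) with ∈⇒≡⊎∈-─ x∈ y∈
... | inj₁ e = inj₁ e
... | inj₂ r = inj₂ (there r)

module _ {𝔾 : Group 0ℓ 0ℓ} {X : Set} (K : Subgroup 𝔾) (A : RightAction 𝔾 X)
         (xs : List X) (∈-xs : ∀ x → x ∈ xs) where
  open Group 𝔾 using (Carrier; ε)
  open Subgroup K
  open RightAction A

  -- A decidable relation contained in the orbit relation needs one group element per related pair,
  -- hence finitely many.
  finite-witnesses : {_~_ : Rel X 0ℓ} → Decidable₂ _~_ → (∀ x y → x ~ y → SameOrbit K A x y) →
    ∃ λ gs → All.All Member gs × (∀ x y → x ~ y → ∃ λ g → g ∈ gs × x ^ g ≡ y)
  finite-witnesses {_~_} _~?_ orbit =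
    map (proj₁ ∘ choice) pairs
    , All.map⁺ (All.tabulate (λ {xy} _ → proj₁ (proj₂ (choice xy))))
    , (λ x y x~y → _ , ∈-map⁺ (proj₁ ∘ choice) (∈-cartesianProduct⁺ (∈-xs x) (∈-xs y)) , proj₂ (proj₂ (choice (x , y))) x~y)
    where
    pairs = cartesianProduct xs xs
    choice : (xy : X × X) → ∃ λ g → Member g × (proj₁ xy ~ proj₂ xy → proj₁ xy ^ g ≡ proj₂ xy)
    choice (x , y) with x ~? y
    ... | yes x~y with g , g∈ , e ← orbit x y x~y = g , g∈ , λ _ → e
    -- Unrelated pairs receive the identity, so that every listed element lies in the subgroup.
    ... | no ¬x~y = ε , ε-closed , λ x~y → ⊥-elim (¬x~y x~y)

  -- A decidable stand-in for the orbit of `x`: images under `gs` are added until nothing new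
  -- appears. Every added element still lies in the orbit.
  closed-suborbit : DecidableEquality X → (gs : List Carrier) → All.All Member gs → ∀ x →
    ∃ λ (S : List X) → x ∈ S × All.All (SameOrbit K A x) S × (∀ {g y} → g ∈ gs → y ∈ S → y ^ g ∈ S)
  closed-suborbit _≟ₓ_ gs gs⊆K x =
    -- The invariant only asks that the two lists together cover X, so `x` may remain in `xs`. The
    -- length of the second list bounds the number of rounds.
    saturate _ (x ∷ []) xs refl (inj₂ ∘ ∈-xs) (here refl) (sameOrbit-refl K A x All.∷ All.[])
    where
    saturate : ∀ n S rest → length rest ≡ n → (∀ y → y ∈ S ⊎ y ∈ rest) → x ∈ S → All.All (SameOrbit K A x) S →
      ∃ λ (S : List X) → x ∈ S × All.All (SameOrbit K A x) S × (∀ {g y} → g ∈ gs → y ∈ S → y ^ g ∈ S)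
    saturate n S rest size cover x∈S S⊆orbit
      with Any.any? (λ z → Any.any? (λ y → Any.any? (λ g → (y ^ g) ≟ₓ z) gs) S) rest
    ... | no none = S , x∈S , S⊆orbit , closed
      where
      closed : ∀ {g y} → g ∈ gs → y ∈ S → y ^ g ∈ S
      closed {g} {y} g∈ y∈ with cover (y ^ g)
      ... | inj₁ in-S    = in-S
      ... | inj₂ in-rest = ⊥-elim (none (lose in-rest (lose y∈ (lose g∈ refl))))
    ... | yes some
      with z , z∈rest , some′ ← find some
      with y , y∈S , some″ ← find some′
      with g , g∈gs , e ← find some″
      with n
    ... | zero  with () ← trans (sym size) (length-removeAt′ rest (Any.index z∈rest))
    ... | suc n = saturate n (z ∷ S) (rest ─ z∈rest)
                    (suc-injective (trans (sym (length-removeAt′ rest (Any.index z∈rest))) size))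
                    cover′ (there x∈S)
                    (sameOrbit-trans K A (All.lookup S⊆orbit y∈S) (g , All.lookup gs⊆K g∈gs , e) All.∷ S⊆orbit)
      where
      cover′ : ∀ w → w ∈ z ∷ S ⊎ w ∈ (rest ─ z∈rest)
      cover′ w with cover w
      ... | inj₁ w∈S = inj₁ (there w∈S)
      ... | inj₂ w∈rest with ∈⇒≡⊎∈-─ w∈rest z∈rest
      ... | inj₁ w≡z = inj₁ (here w≡z)
      ... | inj₂ w∈  = inj₂ w∈

factor-through : ∀ {X : Set} (xs : List X) → (∀ x → x ∈ xs) → (F : X → ℕ) (ρ : X → Bool) →
  (∀ x y → ρ x ≡ ρ y → F x ≡ F y) → ∃ λ h → ∀ x → F x ≡ h (ρ x)
factor-through {X} xs ∈-xs F ρ constant = (λ b → proj₁ (value b)) , λ x → proj₂ (value (ρ x)) x refl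
  where
  value : ∀ b → ∃ λ a → ∀ x → ρ x ≡ b → F x ≡ a
  value b with Any.any? (λ x → ρ x Bool.≟ b) xs
  -- The value for a colour is read off at any element carrying it; a colour that does not occur
  -- gets the default 0.
  ... | yes some with y , _ , e ← find some = F y , λ x e′ → constant x y (trans e′ (sym e))
  ... | no none  = 0 , λ x e → ⊥-elim (none (lose (∈-xs x) e))

-- Recovering orbits on pairs (y , β) in a symmetric design

module _ {D : Design} {v k μ : ℕ} (des : IsTwoDesign D v k μ) (2<k : 2 < k) (k<v : k < v)
         (symmetric : Symmetric D v) (G : Subgroup (Aut D)) where
  open Design D
  open DesignCounting D des 2<k k<v
  open Automorphism
  private module 𝓑 = RightAction (blocks D)

  N-invariant : ∀ p β g → N p β ≡ N (RightAction._^_ (points D) p g) (β 𝓑.^ g)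
  N-invariant p β g = cong 𝟙ᵇ (does-⇔ (preserves g p β) (p I? β) (_ I? _))

  -- Serves twice: with ρ equality of points, and with ρ incidence. The entry of M at (y , β) is
  -- determined by the count in the hypothesis, so equal counts put both pairs into the same closed
  -- set `S`, which lies in one orbit.
  sameOrbit-on-blocks : ∀ {m} (A : RightAction (Aut D) (Fin m)) (ρ : Fin m → Point → Bool) →
    Transitive G A →
    (∀ y q y′ q′ → ρ y q ≡ ρ y′ q′ → SameOrbit G (A ⊗ points D) (y , q) (y′ , q′)) →
    ∀ y β y′ β′ → ∑[ q < #points ] (𝟙ᵇ (ρ y q) * N q β) ≡ ∑[ q < #points ] (𝟙ᵇ (ρ y′ q) * N q β′) →
    SameOrbit G (A ⊗ blocks D) (y , β) (y′ , β′)
  sameOrbit-on-blocks {m} A ρ transitive ρ-transitive y β y′ β′ same-count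
    -- Closure under `gs₁` will make the row sums of M constant; closure under `gs₂` will make M Nᵀ
    -- depend on ρ alone.
    with gs₁ , gs₁⊆G , move₁ ← finite-witnesses G A (allFin m) ∈-allFin {λ _ _ → ⊤} (λ _ _ → yes tt) (λ x z _ → transitive x z)
    with gs₂ , gs₂⊆G , move₂ ← finite-witnesses G (A ⊗ points D) (cartesianProduct (allFin m) (allFin #points))
                                  (λ (x , q) → ∈-cartesianProduct⁺ (∈-allFin x) (∈-allFin q))
                                  (λ (x , q) (x′ , q′) → ρ x q Bool.≟ ρ x′ q′)
                                  (λ (x , q) (x′ , q′) → ρ-transitive x q x′ q′)
    with S , yβ∈S , S⊆orbit , closed ← closed-suborbit G (A ⊗ blocks D) (cartesianProduct (allFin m) (allFin #blocks))
                                  (λ (x , γ) → ∈-cartesianProduct⁺ (∈-allFin x) (∈-allFin γ))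
                                  (≡-dec _≟_ _≟_) (gs₁ ++ gs₂) (All.++⁺ gs₁⊆G gs₂⊆G) (y , β)
    = All.lookup S⊆orbit (𝟙⁻¹ ((y′ , β′) ∈? S) (trans (sym M-agrees) (𝟙-yes ((y , β) ∈? S) yβ∈S)))
    where
    open DecMembership (≡-dec (_≟_ {m}) (_≟_ {#blocks})) using (_∈?_)
    module A = RightAction A

    M : Fin m → Block → ℕ
    M x γ = 𝟙 ((x , γ) ∈? S)

    -- Closure of `S` under a listed element gives only an inequality. Equalities of sums arise
    -- later by antisymmetry, from elements moving in both directions.
    M-mono : ∀ {g} → g ∈ gs₁ ++ gs₂ → ∀ x γ → M x γ ≤ M (x A.^ g) (γ 𝓑.^ g)
    M-mono g∈ x γ = 𝟙-mono-≤ ((x , γ) ∈? S) (_ ∈? S) (closed g∈)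

    rowsum : Fin m → ℕ
    rowsum x = ∑[ γ < #blocks ] M x γ

    rowsum-≤ : ∀ x z → rowsum x ≤ rowsum z
    rowsum-≤ x z with g , g∈ , refl ← move₁ x z tt =
      ≤-trans (sum-mono-≤ (M-mono (∈-++⁺ˡ g∈) x)) (≤-reflexive (sym (∑-permute (M (x A.^ g)) (onB g))))

    MNᵀ : Fin m → Point → ℕ
    MNᵀ x q = ∑[ γ < #blocks ] (M x γ * N q γ)

    MNᵀ-≤ : ∀ x q z r → ρ x q ≡ ρ z r → MNᵀ x q ≤ MNᵀ z r
    MNᵀ-≤ x q z r same with g , g∈ , refl ← move₂ (x , q) (z , r) same =
      ≤-trans (sum-mono-≤ (λ γ → *-mono-≤ (M-mono (∈-++⁺ʳ gs₁ g∈) x γ) (≤-reflexive (N-invariant q γ g))))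
              (≤-reflexive (sym (∑-permute (λ γ → M (x A.^ g) γ * N _ γ) (onB g))))

    through-ρ : ∃ λ h → ∀ ((x , q) : Fin m × Point) → MNᵀ x q ≡ h (ρ x q)
    through-ρ = factor-through (cartesianProduct (allFin m) (allFin #points))
      (λ (x , q) → ∈-cartesianProduct⁺ (∈-allFin x) (∈-allFin q)) (λ (x , q) → MNᵀ x q) (λ (x , q) → ρ x q)
      (λ (x , q) (z , r) same → ≤-antisym (MNᵀ-≤ x q z r same) (MNᵀ-≤ z r x q (sym same)))

    h : Bool → ℕ
    h = proj₁ through-ρ

    MNᵀN : Fin m → Block → ℕ
    MNᵀN x γ = ∑[ q < #points ] (MNᵀ x q * N q γ)

    ρ-count : Fin m → Block → ℕ
    ρ-count x γ = ∑[ q < #points ] (𝟙ᵇ (ρ x q) * N q γ)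

    -- MNᵀN x γ is h true · t + h false · (k − t) for t = ρ-count x γ.
    MNᵀN-count : ∀ x γ → MNᵀN x γ + h false * ρ-count x γ ≡ h true * ρ-count x γ + h false * k
    MNᵀN-count x γ = begin
      MNᵀN x γ + h false * ρ-count x γ
        ≡⟨ cong (MNᵀN x γ +_) (*-distribˡ-sum (h false) t) ⟩
      MNᵀN x γ + ∑[ q < #points ] (h false * t q)
        ≡⟨ ∑-distrib-+ (λ q → MNᵀ x q * N q γ) (λ q → h false * t q) ⟨
      ∑[ q < #points ] (MNᵀ x q * N q γ + h false * t q)
        ≡⟨ sum-cong-≗ (λ q → trans (cong (λ s → s * N q γ + h false * t q) (proj₂ through-ρ (x , q))) (split (ρ x q) (N q γ))) ⟩
      ∑[ q < #points ] (h true * t q + h false * N q γ)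
        ≡⟨ ∑-distrib-+ (λ q → h true * t q) (λ q → h false * N q γ) ⟩
      ∑[ q < #points ] (h true * t q) + ∑[ q < #points ] (h false * N q γ)
        ≡⟨ cong₂ _+_ (*-distribˡ-sum (h true) t) (*-distribˡ-sum (h false) (λ q → N q γ)) ⟨
      h true * ρ-count x γ + h false * ∑[ q < #points ] N q γ
        ≡⟨ cong (λ s → h true * ρ-count x γ + h false * s) (block-sum γ) ⟩
      h true * ρ-count x γ + h false * k ∎
      where
      open ≡-Reasoning
      t : Point → ℕ
      t q = 𝟙ᵇ (ρ x q) * N q γ
      split-true : ∀ a b n → a * n + b * (1 * n) ≡ a * (1 * n) + b * n
      split-true = solve-∀
      split-false : ∀ a b n → b * n + b * (0 * n) ≡ a * (0 * n) + b * n
      split-false = solve-∀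
      split : ∀ c n → h c * n + h false * (𝟙ᵇ c * n) ≡ h true * (𝟙ᵇ c * n) + h false * n
      split true  n = split-true (h true) (h false) n
      split false n = split-false (h true) (h false) n

    MNᵀN-agrees : MNᵀN y β ≡ MNᵀN y′ β′
    MNᵀN-agrees = +-cancelʳ-≡ (h false * ρ-count y β) _ _ (trans (MNᵀN-count y β)
      (subst (λ t → h true * t + h false * k ≡ MNᵀN y′ β′ + h false * t) (sym same-count) (sym (MNᵀN-count y′ β′))))

    -- This is M Nᵀ N = (k - μ) M + μ M J, row by row.
    recover : ∀ x γ → MNᵀN x γ + μ * M x γ ≡ μ * rowsum x + k * M x γ
    recover x γ = gram-apply (λ γ p → N p γ) k μ (block-gram symmetric) (M x) γ

    solution-unique : ∀ {T s a b} → μ < k → T + μ * a ≡ μ * s + k * a → T + μ * b ≡ μ * s + k * b → a ≡ b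
    -- Here k = μ + j + 1, so the coefficient k - μ = j + 1 is nonzero and cancels.
    solution-unique {T} {s} {a} {b} μ<k ea eb with j , refl ← m≤n⇒∃[o]m+o≡n μ<k =
      *-cancelˡ-≡ a b (suc j) (+-cancelˡ-≡ (μ * s) _ _ (trans (sym (shift a ea)) (shift b eb)))
      where
      regroup : ∀ μ s j a → μ * s + suc (μ + j) * a ≡ μ * s + suc j * a + μ * a
      regroup = solve-∀
      shift : ∀ a → T + μ * a ≡ μ * s + suc (μ + j) * a → T ≡ μ * s + suc j * a
      shift a e = +-cancelʳ-≡ (μ * a) _ _ (trans e (regroup μ s j a))

    M-agrees : M y β ≡ M y′ β′
    M-agrees = solution-unique (μ<k symmetric (proj₁ (point-on β))) (recover y β)
      (trans (cong (_+ μ * M y′ β′) MNᵀN-agrees)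
        (trans (recover y′ β′) (cong (λ s → μ * s + k * M y′ β′) (≤-antisym (rowsum-≤ y′ y) (rowsum-≤ y y′)))))

-- Pairwise transitivity

module _ {D : Design} {v k μ : ℕ} (des : IsTwoDesign D v k μ) (2<k : 2 < k) (k<v : k < v) (G : Subgroup (Aut D)) where
  open Design D
  open DesignCounting D des 2<k k<v
  open Automorphism
  private
    𝓟 = points D
    𝓑 = blocks D
    module 𝓟 = RightAction 𝓟
    module 𝓑 = RightAction 𝓑

  intersecting? : ∀ β γ → Dec (Intersecting β γ)
  intersecting? β γ = any? (λ p → (p I? β) ×-dec (p I? γ))

  intersecting-refl : ∀ β → Intersecting β β
  intersecting-refl β with p , p∈β ← point-on β = p , p∈β , p∈β

  intersecting-preserved : ∀ g β γ → Intersecting β γ ⇔ Intersecting (β 𝓑.^ g) (γ 𝓑.^ g)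
  intersecting-preserved g β γ = mk⇔
    (λ { (p , p∈β , p∈γ) → onP g ⟨$⟩ʳ p , to (preserves g p β) p∈β , to (preserves g p γ) p∈γ })
    (λ { (p , p∈β , p∈γ) → onP g ⟨$⟩ˡ p , pull p β p∈β , pull p γ p∈γ })
    where
    open Equivalence using (to; from)
    pull : ∀ p β → p I (onB g ⟨$⟩ʳ β) → (onP g ⟨$⟩ˡ p) I β
    pull p β p∈ = from (preserves g _ β) (subst (_I (onB g ⟨$⟩ʳ β)) (sym (inverseʳ (onP g))) p∈)

  flagColour : Point → Block → Fin 2
  flagColour p β = if does (p I? β) then zero else suc zero

  -- Equality is tested first, since a block also meets itself.
  blockColour : Block → Block → Fin 3
  blockColour β γ = if does (β ≟ γ) then zero else if does (intersecting? β γ) then suc zero else suc (suc zero)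

  flagColour-invariant : ∀ p β g → flagColour (p 𝓟.^ g) (β 𝓑.^ g) ≡ flagColour p β
  flagColour-invariant p β g =
    cong (λ b → if b then zero else suc zero) (sym (does-⇔ (preserves g p β) (p I? β) (_ I? _)))

  blockColour-invariant : ∀ β γ g → blockColour (β 𝓑.^ g) (γ 𝓑.^ g) ≡ blockColour β γ
  blockColour-invariant β γ g = sym (cong₂ (λ b c → if b then zero else if c then suc zero else suc (suc zero))
    (does-⇔ (mk⇔ (cong (onB g ⟨$⟩ʳ_)) injective) (β ≟ γ) (_ ≟ _))
    (does-⇔ (intersecting-preserved g β γ) (intersecting? β γ) (intersecting? _ _)))
    where
    injective : onB g ⟨$⟩ʳ β ≡ onB g ⟨$⟩ʳ γ → β ≡ γ
    injective e = trans (sym (inverseˡ (onB g))) (trans (cong (onB g ⟨$⟩ˡ_) e) (inverseˡ (onB g)))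

  flagColour-on : ∀ {p β} → p I β → flagColour p β ≡ zero
  flagColour-on {p} {β} p∈β with p I? β
  ... | yes _  = refl
  ... | no p∉β = ⊥-elim (p∉β p∈β)

  flagColour-off : ∀ {p β} → ¬ p I β → flagColour p β ≡ suc zero
  flagColour-off {p} {β} p∉β with p I? β
  ... | yes p∈β = ⊥-elim (p∉β p∈β)
  ... | no _    = refl

  blockColour-self : ∀ β → blockColour β β ≡ zero
  blockColour-self β with β ≟ β
  ... | yes _  = refl
  ... | no β≢β = ⊥-elim (β≢β refl)

  blockColour-meeting : ∀ {β γ} → β ≢ γ → Intersecting β γ → blockColour β γ ≡ suc zero
  blockColour-meeting {β} {γ} β≢γ meets with β ≟ γ | intersecting? β γ
  ... | yes β≡γ | _        = ⊥-elim (β≢γ β≡γ)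
  ... | no _    | yes _    = refl
  ... | no _    | no misses = ⊥-elim (misses meets)

  blockColour-disjoint : ∀ {β γ} → ¬ Intersecting β γ → blockColour β γ ≡ suc (suc zero)
  blockColour-disjoint {β} {γ} misses with β ≟ γ | intersecting? β γ
  ... | yes refl | _         = ⊥-elim (misses (intersecting-refl β))
  ... | no _     | yes meets = ⊥-elim (misses meets)
  ... | no _     | no _      = refl

  -- The common form of (c) and (d): each is equivalent to it once G is transitive on points,
  -- respectively on blocks.
  FlagTransitive : Set
  FlagTransitive = ∀ p β p′ β′ → flagColour p β ≡ flagColour p′ β′ → SameOrbit G (𝓟 ⊗ 𝓑) (p , β) (p′ , β′)

  BlockPairTransitive : Set
  BlockPairTransitive = ∀ β γ β′ γ′ → blockColour β γ ≡ blockColour β′ γ′ → SameOrbit G (𝓑 ⊗ 𝓑) (β , γ) (β′ , γ′)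

  disjoint⇒distinct : ∀ {β γ} → ¬ Intersecting β γ → β ≢ γ
  disjoint⇒distinct {β} misses refl = misses (intersecting-refl β)

  points-2-transitive⇔ : ConditionA D G ⇔ (∀ p q p′ q′ → p ≢ q → p′ ≢ q′ → SameOrbit G (𝓟 ⊗ 𝓟) (p , q) (p′ , q′))
  points-2-transitive⇔ = mk⇔
    (λ tr p q p′ q′ n n′ → to (sameOrbit-image²⇔ (pointRep D) G (natural #points)) (tr (p , q) (p′ , q′) n n′))
    (λ tr (p , q) (p′ , q′) n n′ → from (sameOrbit-image²⇔ (pointRep D) G (natural #points)) (tr p q p′ q′ n n′))
    where open Equivalence using (to; from)

  conditionA⇒transitive : ConditionA D G → Transitive G 𝓟
  conditionA⇒transitive a = distinct-pairs⇒transitive G 𝓟 _≟_ (Equivalence.to points-2-transitive⇔ a)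

  -- Some point misses some block, and transitivity carries that point to `p`.
  block-off : Transitive G 𝓟 → ∀ p → ∃ λ β → ¬ p I β
  block-off tr p
    with β , _ ← block-on p
    with q , q∉β ← point-off β
    with g , _ , refl ← tr q p
    = β 𝓑.^ g , λ p∈ → q∉β (Equivalence.from (preserves g q β) p∈)

  conditionC⇔ : Transitive G 𝓟 → ConditionC D G ⇔ FlagTransitive
  conditionC⇔ tr = stabilisers-hasOrbits⇔ G 𝓟 𝓑 flagColour (λ p β {g} _ → flagColour-invariant p β g) section tr
    where
    section : ∀ p i → ∃ λ β → flagColour p β ≡ i
    section p zero       = let β , on = block-on p in β , flagColour-on on
    section p (suc zero) = let β , off = block-off tr p in β , flagColour-off off

  conditionD⇔ : Transitive G 𝓑 → ConditionD D G ⇔ FlagTransitive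
  conditionD⇔ tr = mk⇔
    (λ d p β p′ β′ e → sameOrbit-swap G 𝓑 𝓟 (to d β p β′ p′ e))
    (λ t → from (λ β p β′ p′ e → sameOrbit-swap G 𝓟 𝓑 (t p β p′ β′ e)))
    where
    section : ∀ β i → ∃ λ p → flagColour p β ≡ i
    section β zero       = let p , on = point-on β in p , flagColour-on on
    section β (suc zero) = let p , off = point-off β in p , flagColour-off off
    open Equivalence (stabilisers-hasOrbits⇔ G 𝓑 𝓟 (λ β p → flagColour p β)
      (λ β p {g} _ → flagColour-invariant p β g) section tr)

  -- Transitivity moves the one given disjoint pair to every block, so all three colours occur at
  -- each block and three orbits means one per colour.
  rank-3⇔ : Transitive G 𝓑 → (∃ λ β → ∃ λ γ → ¬ Intersecting β γ) →
            (∀ β → HasOrbits (stabiliser (inducedB D G) (natural #blocks) β) (natural #blocks) 3) ⇔ BlockPairTransitive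
  rank-3⇔ tr (β₀ , γ₀ , disjoint) = mk⇔
    (λ r β γ β′ γ′ e → Image.to (to r β γ β′ γ′ e))
    (λ t → from (λ β γ β′ γ′ e → Image.from (t β γ β′ γ′ e)))
    where
    module Image {β γ β′ γ′} = Equivalence (sameOrbit-image²⇔ (blockRep D) G (natural #blocks) {β} {γ} {β′} {γ′})
    section : ∀ β i → ∃ λ γ → blockColour β γ ≡ i
    section β zero = β , blockColour-self β
    section β (suc zero) = let γ , β≢γ , meets = meeting-block β in γ , blockColour-meeting β≢γ meets
    section β (suc (suc zero)) with g , _ , refl ← tr β₀ β =
      γ₀ 𝓑.^ g , trans (blockColour-invariant β₀ γ₀ g) (blockColour-disjoint disjoint)
    induced-invariant : ∀ β γ {h} → Subgroup.Member (inducedB D G) h →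
                        blockColour (h ⟨$⟩ʳ β) (h ⟨$⟩ʳ γ) ≡ blockColour β γ
    induced-invariant β γ (g , _ , e) = trans (cong₂ blockColour (sym (e β)) (sym (e γ))) (blockColour-invariant β γ g)
    open Equivalence (stabilisers-hasOrbits⇔ (inducedB D G) (natural #blocks) (natural #blocks) blockColour
      induced-invariant section (λ β γ → Equivalence.from (sameOrbit-image⇔ (blockRep D) G (natural #blocks)) (tr β γ)))

  flagTransitive⇔ : FlagTransitive ⇔
    (TransitiveOn G (𝓟 ⊗ 𝓑) (λ { (p , β) → p I β }) × TransitiveOn G (𝓟 ⊗ 𝓑) (λ { (p , β) → ¬ p I β }))
  flagTransitive⇔ = mk⇔
    (λ t → (λ (p , β) (p′ , β′) on on′ → t p β p′ β′ (trans (flagColour-on on) (sym (flagColour-on on′))))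
         , (λ (p , β) (p′ , β′) off off′ → t p β p′ β′ (trans (flagColour-off off) (sym (flagColour-off off′)))))
    from
    where
    from : _ × _ → FlagTransitive
    from (flags , antiflags) p β p′ β′ e with p I? β | p′ I? β′
    ... | yes on | yes on′ = flags (p , β) (p′ , β′) on on′
    ... | no off | no off′ = antiflags (p , β) (p′ , β′) off off′
    from (flags , antiflags) p β p′ β′ () | yes _ | no _
    from (flags , antiflags) p β p′ β′ () | no _ | yes _

  BlockPairs : Set
  BlockPairs = TransitiveOn G (𝓑 ⊗ 𝓑) (λ { (β , γ) → β ≢ γ × Intersecting β γ })
             × TransitiveOn G (𝓑 ⊗ 𝓑) (λ { (β , γ) → ¬ Intersecting β γ })

  blockPairTransitive⇔ : Transitive G 𝓑 → BlockPairTransitive ⇔ BlockPairs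
  blockPairTransitive⇔ tr = mk⇔
    (λ t → (λ (β , γ) (β′ , γ′) (n , i) (n′ , i′) → t β γ β′ γ′ (trans (blockColour-meeting n i) (sym (blockColour-meeting n′ i′))))
         , (λ (β , γ) (β′ , γ′) d d′ → t β γ β′ γ′ (trans (blockColour-disjoint d) (sym (blockColour-disjoint d′)))))
    from
    where
    from : BlockPairs → BlockPairTransitive
    from (meeting , disjoint) β γ β′ γ′ e with β ≟ γ | β′ ≟ γ′ | intersecting? β γ | intersecting? β′ γ′
    ... | yes refl | yes refl | _     | _      = diagonal G 𝓑 tr β β′
    ... | no n     | no n′    | yes i | yes i′ = meeting (β , γ) (β′ , γ′) (n , i) (n′ , i′)
    ... | no _     | no _     | no d  | no d′  = disjoint (β , γ) (β′ , γ′) d d′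
    from _ β γ β′ γ′ () | yes _ | no _  | _     | yes _
    from _ β γ β′ γ′ () | yes _ | no _  | _     | no _
    from _ β γ β′ γ′ () | no _  | yes _ | yes _ | _
    from _ β γ β′ γ′ () | no _  | yes _ | no _  | _
    from _ β γ β′ γ′ () | no _  | no _  | yes _ | no _
    from _ β γ β′ γ′ () | no _  | no _  | no _  | yes _

  -- Disjoint blocks are distinct because blocks are nonempty, so 2-transitivity covers both classes
  -- of pairs. Conversely, a finite search for a disjoint pair selects the alternative: if one
  -- exists the rank is 3, otherwise all distinct blocks meet and the action is 2-transitive.
  conditionB⇔ : ConditionB D G ⇔ (Transitive G 𝓑 × BlockPairs)
  conditionB⇔ = mk⇔ to from
    where
    module Image {β γ β′ γ′} = Equivalence (sameOrbit-image²⇔ (blockRep D) G (natural #blocks) {β} {γ} {β′} {γ′})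
    to : ConditionB D G → Transitive G 𝓑 × BlockPairs
    to (inj₁ two) = distinct-pairs⇒transitive G 𝓑 _≟_ pairs
                  , (λ (β , γ) (β′ , γ′) (n , _) (n′ , _) → pairs β γ β′ γ′ n n′)
                  , (λ (β , γ) (β′ , γ′) d d′ → pairs β γ β′ γ′ (disjoint⇒distinct d) (disjoint⇒distinct d′))
      where
      pairs : ∀ β γ β′ γ′ → β ≢ γ → β′ ≢ γ′ → SameOrbit G (𝓑 ⊗ 𝓑) (β , γ) (β′ , γ′)
      pairs β γ β′ γ′ n n′ = Image.to (two (β , γ) (β′ , γ′) n n′)
    to (inj₂ ((tr , orbits) , disjoint)) =
      tr′ , Equivalence.to (blockPairTransitive⇔ tr′) (Equivalence.to (rank-3⇔ tr′ disjoint) orbits)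
      where
      tr′ : Transitive G 𝓑
      tr′ β γ = Equivalence.to (sameOrbit-image⇔ (blockRep D) G (natural #blocks)) (tr β γ)
    from : Transitive G 𝓑 × BlockPairs → ConditionB D G
    from (tr , pairs@(meeting , _)) with any? (λ β → any? (λ γ → ¬? (intersecting? β γ)))
    ... | yes disjoint = inj₂ (((λ β γ → Equivalence.from (sameOrbit-image⇔ (blockRep D) G (natural #blocks)) (tr β γ))
                               , Equivalence.from (rank-3⇔ tr disjoint) (Equivalence.from (blockPairTransitive⇔ tr) pairs))
                              , disjoint)
    ... | no none = inj₁ λ (β , γ) (β′ , γ′) n n′ → Image.from (meeting (β , γ) (β′ , γ′) (n , meets β γ) (n′ , meets β′ γ′))
      where
      meets : ∀ β γ → Intersecting β γ
      meets β γ = decidable-stable (intersecting? β γ) (λ d → none (β , γ , d))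

  pairwiseTransitive⇔ : PairwiseTransitive D G ⇔ (ConditionA D G × ConditionB D G × FlagTransitive)
  pairwiseTransitive⇔ = mk⇔ to from
    where
    to : PairwiseTransitive D G → ConditionA D G × ConditionB D G × FlagTransitive
    to pt = Equivalence.from points-2-transitive⇔ (λ p q p′ q′ → distinct-points (p , q) (p′ , q′))
          , Equivalence.from conditionB⇔ (block-transitive , (λ (β , γ) (β′ , γ′) → intersecting (β , γ) (β′ , γ′))
                                                           , (λ (β , γ) (β′ , γ′) → non-intersecting (β , γ) (β′ , γ′)))
          , Equivalence.from flagTransitive⇔ ((λ (p , β) (p′ , β′) → flags (p , β) (p′ , β′))
                                             , (λ (p , β) (p′ , β′) → antiflags (p , β) (p′ , β′)))
      where
      open PairwiseTransitive pt
      block-transitive : Transitive G 𝓑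
      -- Every block carries a point, so moving flags moves blocks.
      block-transitive β γ =
        let p , p∈β = point-on β
            q , q∈γ = point-on γ
            g , g∈ , e = flags (p , β) (q , γ) p∈β q∈γ
        in g , g∈ , cong proj₂ e
    from : ConditionA D G × ConditionB D G × FlagTransitive → PairwiseTransitive D G
    from (a , b , t) =
      let _ , meeting , disjoint = Equivalence.to conditionB⇔ b
          flags , antiflags = Equivalence.to flagTransitive⇔ t
      in record
        { distinct-points  = λ (p , q) (p′ , q′) → Equivalence.to points-2-transitive⇔ a p q p′ q′
        ; flags            = λ (p , β) (p′ , β′) → flags (p , β) (p′ , β′)
        ; antiflags        = λ (p , β) (p′ , β′) → antiflags (p , β) (p′ , β′)
        ; intersecting     = λ (β , γ) (β′ , γ′) → meeting (β , γ) (β′ , γ′)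
        ; non-intersecting = λ (β , γ) (β′ , γ′) → disjoint (β , γ) (β′ , γ′)
        }

  symmetric-2-transitive⇒pairwiseTransitive : Symmetric D v → ConditionA D G → PairwiseTransitive D G
  symmetric-2-transitive⇒pairwiseTransitive symmetric a = Equivalence.from pairwiseTransitive⇔
    (a , Equivalence.from conditionB⇔ (block-transitive , (λ (β , γ) (β′ , γ′) (n , _) (n′ , _) → block-pairs β γ β′ γ′ n n′)
                                      , (λ (β , γ) (β′ , γ′) d d′ → block-pairs β γ β′ γ′ (disjoint⇒distinct d) (disjoint⇒distinct d′)))
       , flag-transitive)
    where
    point-pairs : ∀ p q p′ q′ → does (p ≟ q) ≡ does (p′ ≟ q′) → SameOrbit G (𝓟 ⊗ 𝓟) (p , q) (p′ , q′)
    point-pairs p q p′ q′ e with p ≟ q | p′ ≟ q′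
    ... | yes refl | yes refl = diagonal G 𝓟 (conditionA⇒transitive a) p p′
    ... | no n     | no n′    = Equivalence.to points-2-transitive⇔ a p q p′ q′ n n′
    point-pairs p q p′ q′ () | yes _ | no _
    point-pairs p q p′ q′ () | no _ | yes _

    incidence-transitive : ∀ p β p′ β′ → N p β ≡ N p′ β′ → SameOrbit G (𝓟 ⊗ 𝓑) (p , β) (p′ , β′)
    -- With ρ the equality of points, the count collapses to the single entry of N at (p , β).
    incidence-transitive p β p′ β′ e = sameOrbit-on-blocks des 2<k k<v symmetric G 𝓟 (λ p q → does (p ≟ q))
      (conditionA⇒transitive a) point-pairs p β p′ β′ (trans (pick p β) (trans e (sym (pick p′ β′))))
      where
      pick : ∀ p β → ∑[ q < #points ] (𝟙 (p ≟ q) * N q β) ≡ N p β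
      pick p β = trans (sum-cong-≗ (λ q → *-comm (𝟙 (p ≟ q)) (N q β))) (∑-*-𝟙-≟ (λ q → N q β) p)

    flag-transitive : FlagTransitive
    flag-transitive = Equivalence.from flagTransitive⇔
      ( (λ (p , β) (p′ , β′) on on′ → incidence-transitive p β p′ β′ (trans (𝟙-yes (p I? β) on) (sym (𝟙-yes (p′ I? β′) on′))))
      , (λ (p , β) (p′ , β′) off off′ → incidence-transitive p β p′ β′ (trans (𝟙-no (p I? β) off) (sym (𝟙-no (p′ I? β′) off′)))))

    block-transitive : Transitive G 𝓑
    block-transitive β γ =
      let p , p∈β = point-on β
          q , q∈γ = point-on γ
          g , g∈ , e = proj₁ (Equivalence.to flagTransitive⇔ flag-transitive) (p , β) (q , γ) p∈β q∈γ
      in g , g∈ , cong proj₂ e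

    block-pairs : ∀ β γ β′ γ′ → β ≢ γ → β′ ≢ γ′ → SameOrbit G (𝓑 ⊗ 𝓑) (β , γ) (β′ , γ′)
    -- With ρ the incidence relation, the count is the number of points common to β and γ, which is
    -- μ for distinct blocks.
    block-pairs β γ β′ γ′ n n′ = sameOrbit-on-blocks des 2<k k<v symmetric G 𝓑 (λ β q → does (q I? β))
      block-transitive
      (λ β q β′ q′ e → sameOrbit-swap G 𝓟 𝓑 (incidence-transitive q β q′ β′ (cong 𝟙ᵇ e)))
      β γ β′ γ′ (trans (meet-distinct symmetric n) (sym (meet-distinct symmetric n′)))

lemma2p3 : (D : Design) (v k μ : ℕ) → IsTwoDesign D v k μ → NonTrivial v k →
    (G : Subgroup (Aut D)) →
    ((PairwiseTransitive D G ⇔ (ConditionA D G × ConditionB D G × ConditionC D G)) ×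
    (PairwiseTransitive D G ⇔ (ConditionA D G × ConditionB D G × ConditionD D G))) ×
    (Symmetric D v → (PairwiseTransitive D G ⇔ TwoTransitive (inducedP D G)))
lemma2p3 D v k μ des (2<k , k<v) G =
  ( mk⇔ (λ pt → let a , b , t = to pw pt in a , b , from (C a) t)
        (λ (a , b , c) → from pw (a , b , to (C a) c))
  , mk⇔ (λ pt → let a , b , t = to pw pt in a , b , from (D′ b) t)
        (λ (a , b , d) → from pw (a , b , to (D′ b) d)) )
  , λ symmetric → mk⇔ (λ pt → proj₁ (to pw pt)) (symmetric-2-transitive⇒pairwiseTransitive des 2<k k<v G symmetric)
  where
  open Equivalence using (to; from)
  pw = pairwiseTransitive⇔ des 2<k k<v G
  -- Point transitivity, needed for (c), comes from (a); block transitivity, needed for (d), comes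
  -- from (b).
  C  = λ a → conditionC⇔ des 2<k k<v G (conditionA⇒transitive des 2<k k<v G a)
  D′ = λ b → conditionD⇔ des 2<k k<v G (proj₁ (to (conditionB⇔ des 2<k k<v G) b))
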